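{- Let $G$ be a unicyclic graph with $n \ge 4$ vertices and maximum degree $\Delta \ge 3$, let $q=\lfloor \frac{n}{\Delta-1}\rfloor$, and let $f : [1,\infty) \to \mathbb{R}^+$ be a function such that $\log f$ is concave. If $q=1$ or $n=2\Delta-2$, then $$ II_f(G) \ge f(\Delta)\, f(n-\Delta+1)\, f(2)\, f(1)^{n-3}. $$ If $q>1$ and $n\ne 2\Delta-2$, then $$ II_f(G) \ge f(\Delta)^q\, f\big(n-q(\Delta-1)+1\big)\, f(1)^{n-q-1}. $$ Both inequalities are attained (i.e., equality holds in the respective case) if and only if $G \in \mathcal{K}_n^\Delta$.
   Context: All graphs are finite, connected, simple (no loops, no multiple edges) and have at least one edge. A unicyclic graph is a graph containing exactly one cycle. For a vertex $u$ of $G$, $d_u$ denotes its degree. $\mathbb{R}^+$ denotes the positive real numbers. For a function $f:[1,\infty)\to\mathbb{R}^+$, $II_f(G) = \prod_{u\in V(G)} f(d_u)$. For $n\ge 4$, $3\le\Delta\le n-1$ and $q=\lfloor \frac{n}{\Delta-1}\rfloor$, define the $n$-tuple $\mathbf{z}$ as follows. If $q=1$ or $n=2\Delta-2$, then $\mathbf{z}=(\Delta,\,n-\Delta+1,\,2,\,1,\dots,1)$ with $n-3$ entries equal to $1$ at the end. If $q\ge 2$ and $n\ne 2\Delta-2$, then $\mathbf{z}=(z_1,\dots,z_n)$ with $z_j=\Delta$ for $1\le j\le q$, $z_{q+1}=n-q(\Delta-1)+1$, and $z_j=1$ for $q+1<j\le n$. $\mathcal{K}_n^\Delta$ is the set of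 unicyclic graphs with $n$ vertices whose degree sequence (in non-increasing order) is $\mathbf{z}$.
   Formalization: That equality implies G ∈ K_n^Δ is claimed only when log f is strictly concave: for f ≡ 1 equality holds for every G, e.g. the 4-cycle with a pendant vertex (n=5, Δ=3), which is not in K. The inequalities and "G ∈ K implies equality" hold for all concave log f. -}

module Defs where

open import Algebra.Apartness.Bundles using (HeytingField)
open import Algebra.Bundles using (CommutativeRing; Semiring)
import Algebra.Definitions.RawSemiring as RawSemiringDefinitions
open import Data.Fin.Base using (Fin)
open import Data.List.Base using (List; _∷_; _++_; _∷ʳ_; length; map; filter; allFin; replicate)
open import Data.List.Extrema.Nat using (max)
open import Data.List.Relation.Unary.Linked using (Linked)
open import Data.List.Relation.Unary.Unique.Propositional using (Unique)
import Data.List.Sort as Sort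
open import Data.Nat.Base as ℕ using (ℕ; zero; suc; >-nonZero; s≤s; z≤n)
import Data.Nat.DivMod as ℕ
import Data.Nat.Properties as ℕ
open import Data.Product.Base using (Σ; ∃; ∃₂; _×_; _,_; proj₁)
open import Data.Sum.Base using (_⊎_; inj₁; inj₂)
open import Function.Bundles using (_⇔_; Equivalence)
open import Level using (Level; _⊔_; 0ℓ) renaming (suc to lsuc)
open import Relation.Binary.Construct.Closure.ReflexiveTransitive using (Star)
open import Relation.Binary.Core using (Rel)
import Relation.Binary.Construct.Flip.EqAndOrd as Flip
open import Relation.Binary.Definitions using (Decidable; Symmetric; Irreflexive)
open import Relation.Binary.PropositionalEquality.Core using (_≡_)
open import Relation.Binary.Structures using (IsStrictPartialOrder)
open import Relation.Nullary.Decidable using (does; _⊎-dec_)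
open import Relation.Nullary.Negation using (¬_)
open import Data.Bool.Base using (if_then_else_)

record Graph (n : ℕ) : Set₁ where
  infix 4 _~_ _~?_
  field
    _~_      : Rel (Fin n) 0ℓ
    _~?_     : Decidable _~_
    ~-sym    : Symmetric _~_
    ~-irrefl : Irreflexive _≡_ _~_

module _ {n : ℕ} (G : Graph n) where
  open Graph G

  degree : Fin n → ℕ
  degree u = length (filter (u ~?_) (allFin n))

  degrees : List ℕ
  degrees = map degree (allFin n)

  maxDegree : ℕ
  maxDegree = max 0 degrees

  -- The degrees in non-increasing order.
  degreeSequence : List ℕ
  degreeSequence = Sort.sort (Flip.decTotalOrder ℕ.≤-decTotalOrder) degrees

  Connected : Set
  Connected = ∀ u v → Star _~_ u v

  -- A traversal of a cycle: a starting vertex followed by the remaining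
  -- vertices in the order in which they are met.
  record Cycle : Set where
    field
      start    : Fin n
      rest     : List (Fin n)

    closedWalk : List (Fin n)
    closedWalk = start ∷ rest ∷ʳ start

    field
      distinct : Unique (start ∷ rest)
      long     : 2 ℕ.≤ length rest
      adjacent : Linked _~_ closedWalk

  Consecutive : Fin n → Fin n → List (Fin n) → Set
  Consecutive u v xs = ∃₂ λ ys zs → xs ≡ ys ++ u ∷ v ∷ zs

  CycleEdge : Cycle → Fin n → Fin n → Set
  CycleEdge C u v = Consecutive u v closedWalk ⊎ Consecutive v u closedWalk
    where open Cycle C

  -- Traversals describe the same cycle (a subgraph) precisely when they have
  -- the same edges; this forgets the starting vertex and the direction.
  SameCycle : Cycle → Cycle → Set
  SameCycle C D = ∀ u v → CycleEdge C u v ⇔ CycleEdge D u v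

  ExactlyOneCycle : Set
  ExactlyOneCycle = Σ Cycle λ C → ∀ D → SameCycle C D

  Unicyclic : Set
  Unicyclic = Connected × ExactlyOneCycle

-- ⌊ n / (Δ − 1) ⌋
quot : (n Δ : ℕ) → .(3 ℕ.≤ Δ) → ℕ
quot n Δ 3≤Δ = ℕ._/_ n (Δ ℕ.∸ 1) {{>-nonZero (ℕ.≤-trans (s≤s z≤n) (ℕ.∸-monoˡ-≤ 1 3≤Δ))}}

-- Truncated subtraction is genuine subtraction here when Δ + 1 ≤ n:
-- q (Δ − 1) ≤ n and q + 1 ≤ n.
extremalSequence : (n Δ : ℕ) → .(3 ℕ.≤ Δ) → List ℕ
extremalSequence n Δ 3≤Δ =
  if does ((q ℕ.≟ 1) ⊎-dec (n ℕ.≟ 2 ℕ.* Δ ℕ.∸ 2))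
  then Δ ∷ n ℕ.∸ Δ ℕ.+ 1 ∷ 2 ∷ replicate (n ℕ.∸ 3) 1
  else replicate q Δ ++ (n ℕ.∸ q ℕ.* (Δ ℕ.∸ 1) ℕ.+ 1) ∷ replicate (n ℕ.∸ q ℕ.∸ 1) 1
  where q = quot n Δ 3≤Δ

𝒦 : (n Δ : ℕ) → .(3 ℕ.≤ Δ) → Graph n → Set
𝒦 n Δ 3≤Δ G = Unicyclic G × degreeSequence G ≡ extremalSequence n Δ 3≤Δ

-- The real numbers, axiomatically: a Cauchy complete Archimedean ordered
-- field.  The axioms are the constructive ones, so that x ≤ y means ¬ (y < x)
-- and linearity of _<_ takes the form of cotransitivity, which is inherited
-- from the apartness relation.  Classically every model is isomorphic to ℝ.

record RealNumberSystem (c ℓ₁ ℓ₂ : Level) : Set (lsuc (c ⊔ ℓ₁ ⊔ ℓ₂)) where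
  field
    heytingField : HeytingField c ℓ₁ ℓ₂

  open HeytingField heytingField public

  commutativeRing : CommutativeRing c ℓ₁
  commutativeRing = record { isCommutativeRing = isCommutativeRing }

  open RawSemiringDefinitions (Semiring.rawSemiring (CommutativeRing.semiring commutativeRing)) public
    using (_^_; product) renaming (_×_ to _·_)

  fromℕ : ℕ → Carrier
  fromℕ n = n · 1#

  infix 4 _<_ _≤_
  field
    _<_                  : Rel Carrier ℓ₂
    isStrictPartialOrder : IsStrictPartialOrder _≈_ _<_
    #⇔<⊎>                : ∀ {x y} → x # y ⇔ (x < y ⊎ y < x)
    0<1                  : 0# < 1#
    +-monoˡ-<            : ∀ z {x y} → x < y → x + z < y + z
    *-pos                : ∀ {x y} → 0# < x → 0# < y → 0# < x * y
    archimedean          : ∀ x → ∃ λ n → x < fromℕ n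

  _≤_ : Rel Carrier ℓ₂
  x ≤ y = ¬ (y < x)

  Converges : (ℕ → Carrier) → Carrier → Set (c ⊔ ℓ₂)
  Converges s l = ∀ ε → 0# < ε →
    ∃ λ N → ∀ n → N ℕ.≤ n → (l < s n + ε) × (s n < l + ε)

  Cauchy : (ℕ → Carrier) → Set (c ⊔ ℓ₂)
  Cauchy s = ∀ ε → 0# < ε →
    ∃ λ N → ∀ m n → N ℕ.≤ m → N ℕ.≤ n → s m < s n + ε

  field
    complete : ∀ s → Cauchy s → ∃ (Converges s)

module RealAnalysis {c ℓ₁ ℓ₂ : Level} (R : RealNumberSystem c ℓ₁ ℓ₂) where
  open RealNumberSystem R public
  open IsStrictPartialOrder isStrictPartialOrder
    using () renaming (<-respˡ-≈ to <-respˡ; <-respʳ-≈ to <-respʳ; trans to <-trans)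

  0<fromℕ-suc : ∀ n → 0# < fromℕ (suc n)
  0<fromℕ-suc zero    = <-respʳ (sym (+-identityʳ 1#)) 0<1
  0<fromℕ-suc (suc n) =
    <-trans (0<fromℕ-suc n) (<-respˡ (+-identityˡ _) (+-monoˡ-< (fromℕ (suc n)) 0<1))

  -- 1 / (n + 1)
  reciprocal-suc : ℕ → Carrier
  reciprocal-suc n =
    proj₁ (#⇒invertible (Equivalence.from #⇔<⊎> (inj₂ (0<fromℕ-suc n))))

  -- y is the natural logarithm of x: x = e ^ y, where
  -- e ^ y = lim (1 + y / m) ^ m, taken over m = n + 1.
  _IsLogOf_ : Rel Carrier (c ⊔ ℓ₂)
  y IsLogOf x = Converges (λ n → (1# + y * reciprocal-suc n) ^ suc n) x

  -- A function [1,∞) → ℝ⁺ is represented by a total function whose values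
  -- outside [1,∞) are unconstrained; II evaluates it only at degrees, which are
  -- at least 1 in a connected graph with at least two vertices.
  record IsPositiveFunction (f : Carrier → Carrier) : Set (c ⊔ ℓ₁ ⊔ ℓ₂) where
    field
      cong     : ∀ {x y} → 1# ≤ x → 1# ≤ y → x ≈ y → f x ≈ f y
      positive : ∀ {x} → 1# ≤ x → 0# < f x

  Concave : (Carrier → Carrier) → Set (c ⊔ ℓ₂)
  Concave g = ∀ x y t → 1# ≤ x → 1# ≤ y → 0# ≤ t → t ≤ 1# →
    t * g x + (1# - t) * g y ≤ g (t * x + (1# - t) * y)

  StrictlyConcave : (Carrier → Carrier) → Set (c ⊔ ℓ₂)
  StrictlyConcave g = ∀ x y t → 1# ≤ x → 1# ≤ y → x # y → 0# < t → t < 1# →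
    t * g x + (1# - t) * g y < g (t * x + (1# - t) * y)

  -- g = log f on [1,∞)
  _IsLogFunctionOf_ : (Carrier → Carrier) → (Carrier → Carrier) → Set (c ⊔ ℓ₂)
  g IsLogFunctionOf f = ∀ x → 1# ≤ x → g x IsLogOf f x

  LogConcave : (Carrier → Carrier) → Set (c ⊔ ℓ₂)
  LogConcave f = ∃ λ g → g IsLogFunctionOf f × Concave g

  StrictlyLogConcave : (Carrier → Carrier) → Set (c ⊔ ℓ₂)
  StrictlyLogConcave f = ∃ λ g → g IsLogFunctionOf f × StrictlyConcave g

  II : ∀ {n} → (Carrier → Carrier) → Graph n → Carrier
  II f G = product λ u → f (fromℕ (degree G u))

{-# OPTIONS --safe #-}

-- Orienting the cycle cyclically and every other edge towards it turns a
-- unicyclic graph into a functional graph u ↦ next u.  Hence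
-- degree = 1 + indegree, the indegrees sum to n, and three vertices have
-- positive indegree.  Log-concavity says that replacing indegrees x + j and
-- x + k by x and x + j + k (j, k ≥ 1) does not increase the product; such moves
-- lead from any admissible sequence of indegrees to the extremal one.
module Submission where

open import Defs
open import Algebra.Apartness.Bundles using (HeytingField)
import Algebra.Apartness.Properties.HeytingCommutativeRing as HeytingProperties
open import Algebra.Bundles using (CommutativeRing)
import Algebra.Properties.CommutativeSemiring.Exp as Exp
import Algebra.Properties.Ring as RingProperties
import Algebra.Solver.Ring.NaturalCoefficients.Default as SemiringSolver
open import Data.Bool.Base using (if_then_else_; true; false)
open import Data.Fin.Base using (Fin; zero; suc)
open import Data.Fin.Properties using (_≟_; any?)
open import Data.List.Base
  using (List; []; _∷_; _++_; _∷ʳ_; foldr; length; map; filter; allFin; tabulate; replicate)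
import Data.List.Extrema as Extrema
open import Data.List.Extrema.Nat using (xs≤max)
open import Data.List.Membership.Propositional using (_∈_)
open import Data.List.Membership.Propositional.Properties
  using (∈-∃++; ∈-allFin; ∈-map⁻; ∈-tabulate⁻)
open import Data.List.Properties
  using (length-tabulate; length-replicate; length-++; map-++; map-replicate; map-∘; map-id;
         map-tabulate; tabulate-cong)
import Data.List.Relation.Binary.Pointwise as Pointwise
open import Data.List.Relation.Binary.Permutation.Propositional as Perm
  using (_↭_; ↭-refl; ↭-sym; ↭-trans; ↭-reflexive; prep; swap; ↭⇒↭ₛ)
open import Data.List.Relation.Binary.Permutation.Propositional.Properties
  using (shift; drop-∷; map⁺; ↭-length; ∈-resp-↭)
open import Data.List.Relation.Unary.All as All using (All; []; _∷_)
import Data.List.Relation.Unary.All.Properties as All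
open import Data.List.Relation.Unary.AllPairs.Core using ([]; _∷_)
open import Data.List.Relation.Unary.Any using (here; there)
open import Data.List.Relation.Unary.Linked as Linked using (Linked; [-]; _∷_)
import Data.List.Relation.Unary.Linked.Properties as Linked
open import Data.List.Relation.Unary.Sorted.TotalOrder.Properties using (↗↭↗⇒≋)
open import Data.List.Relation.Unary.Unique.Propositional using (Unique)
import Data.List.Sort as Sort
open import Data.Nat.Base as ℕ using (ℕ; zero; suc; _∸_; z≤n; s≤s; NonZero)
open import Data.Nat.DivMod
  using (_/_; _%_; +-distrib-/-∣ʳ; m<n⇒m/n≡0; m*n/n≡m; m≡m%n+[m/n]*n; m%n<n)
open import Data.Nat.Divisibility using (n∣m*n)
open import Data.Nat.Induction using (<-wellFounded)
open import Data.Nat.ListAction using (sum)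
open import Data.Nat.ListAction.Properties using (sum-↭; sum-++)
import Data.Nat.Properties as ℕ
import Data.Nat.Solver as ℕ
open import Data.Product.Base using (∃; ∃₂; _×_; _,_; proj₁; proj₂)
open import Data.Sum.Base as Sum using (_⊎_; inj₁; inj₂; [_,_]′)
open import Function.Base using (_∘_; id)
open import Function.Bundles using (Equivalence)
open import Induction.WellFounded using (Acc; acc)
open import Level using (Level; 0ℓ; _⊔_)
open import Relation.Binary.Bundles using (DecTotalOrder)
open import Relation.Binary.Construct.Closure.ReflexiveTransitive as Star
  using (Star; _◅_; _◅◅_)
import Relation.Binary.Construct.Flip.EqAndOrd as Flip
open import Relation.Binary.Core using (Rel)
open import Relation.Binary.Definitions using (Symmetric)
open import Relation.Binary.PropositionalEquality as ≡ using (_≡_; _≢_; ≢-sym)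
import Relation.Binary.Reasoning.Base.Triple as TripleReasoning
open import Relation.Binary.Structures using (IsPreorder; IsStrictPartialOrder)
open import Relation.Nullary.Decidable
  using (Dec; yes; no; does; dec-true; dec-false; ¬?; _×-dec_; _⊎-dec_)
open import Relation.Nullary.Negation using (¬_; contradiction)
open import Relation.Unary using (Decidable)
open import Algebra.Properties.CommutativeMonoid.Sum ℕ.+-0-commutativeMonoid
  using (∑-distrib-+; ∑-comm; sum-cong-≗; sum-replicate-zero) renaming (sum to ∑)

-- Ordered field arithmetic

-- The exception n = 2Δ - 2 comes from the three positive indegrees. With D = Δ - 1, concentrating a
-- sum n in entries of size at most D ends in q copies of D and a remainder n - qD. As q is at least
-- 1, this has fewer than three positive entries exactly when q = 1 or n = 2D; one unit then has to
-- stay behind in a third entry, which is the origin of the factor f(2). On the analytic side, the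
-- logarithm is given only through the limit of (1 + y/m)^m. Limits preserve weak inequalities only,
-- so strict concavity is first turned into a quantitative gain that survives the passage to the
-- limit. All that is extracted from concavity is the comparison of f(k+1) f(k+3) with the square of
-- f(k+2); every move on indegrees follows from it by multiplying ratios.

module OrderedField {c ℓ₁ ℓ₂ : Level} (R : RealNumberSystem c ℓ₁ ℓ₂) where
  open RealAnalysis R public hiding (zero)
  open CommutativeRing commutativeRing public using (commutativeSemiring; ring)
  open IsStrictPartialOrder isStrictPartialOrder public using ()
    renaming (<-respˡ-≈ to <-respˡ; <-respʳ-≈ to <-respʳ; <-resp-≈ to <-resp-≈;
              trans to <-trans; irrefl to <-irrefl; asym to <-asym)
  open HeytingProperties (HeytingField.heytingCommutativeRing heytingField) public
    using (invertibleˡ⇒#; x-0≈x)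
  open RingProperties ring public using (-‿distribˡ-*)
  open Exp commutativeSemiring public using (^-distrib-*)
  open SemiringSolver commutativeSemiring public
    using (solve; con; _:+_; _:*_; _:=_)

  <-cotrans : ∀ {x y} → x < y → ∀ z → x < z ⊎ z < y
  <-cotrans x<y z with #-cotrans (Equivalence.from #⇔<⊎> (inj₁ x<y)) z
  ... | inj₁ x#z with Equivalence.to #⇔<⊎> x#z
  ...   | inj₁ x<z = inj₁ x<z
  ...   | inj₂ z<x = inj₂ (<-trans z<x x<y)
  <-cotrans x<y z | inj₂ z#y with Equivalence.to #⇔<⊎> z#y
  ...   | inj₁ z<y = inj₂ z<y
  ...   | inj₂ y<z = inj₁ (<-trans x<y y<z)

  <⇒≤ : ∀ {x y} → x < y → x ≤ y
  <⇒≤ = <-asym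

  <-≤-trans : ∀ {x y z} → x < y → y ≤ z → x < z
  <-≤-trans {z = z} x<y y≤z with <-cotrans x<y z
  ... | inj₁ x<z = x<z
  ... | inj₂ z<y = contradiction z<y y≤z

  ≤-<-trans : ∀ {x y z} → x ≤ y → y < z → x < z
  ≤-<-trans {x = x} x≤y y<z with <-cotrans y<z x
  ... | inj₁ y<x = contradiction y<x x≤y
  ... | inj₂ x<z = x<z

  ≤-trans : ∀ {x y z} → x ≤ y → y ≤ z → x ≤ z
  ≤-trans x≤y y≤z z<x = y≤z (<-≤-trans z<x x≤y)

  ≤-reflexive : ∀ {x y} → x ≈ y → x ≤ y
  ≤-reflexive x≈y y<x = <-irrefl (sym x≈y) y<x

  ≤-isPreorder : IsPreorder _≈_ _≤_
  ≤-isPreorder = record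
    { isEquivalence = isEquivalence
    ; reflexive     = ≤-reflexive
    ; trans         = ≤-trans
    }

  module ≤-Reasoning =
    TripleReasoning ≤-isPreorder <-asym <-trans <-resp-≈ <⇒≤ <-≤-trans ≤-<-trans

  ≮∧≯⇒≈ : ∀ {x y} → ¬ (x < y) → ¬ (y < x) → x ≈ y
  ≮∧≯⇒≈ {x} {y} x≮y y≮x = proj₁ (tight x y) λ x#y → case (Equivalence.to #⇔<⊎> x#y)
    where
    case : ¬ (x < y ⊎ y < x)
    case (inj₁ x<y) = x≮y x<y
    case (inj₂ y<x) = y≮x y<x

  -- Trichotomy is available when the goal is a negation.
  by-trichotomy : ∀ {a} {A : Set a} x y →
    (x < y → ¬ A) → (x ≈ y → ¬ A) → (y < x → ¬ A) → ¬ A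
  by-trichotomy x y lt eq gt a = eq (≮∧≯⇒≈ (λ x<y → lt x<y a) (λ y<x → gt y<x a)) a

  +-cancelʳ′ : ∀ x z → (x + z) + - z ≈ x
  +-cancelʳ′ x z = trans (+-assoc x z (- z)) (trans (+-congˡ (-‿inverseʳ z)) (+-identityʳ x))

  +-monoʳ-< : ∀ z {x y} → x < y → z + x < z + y
  +-monoʳ-< z {x} {y} x<y = <-respˡ (+-comm x z) (<-respʳ (+-comm y z) (+-monoˡ-< z x<y))

  +-mono-< : ∀ {x y u v} → x < y → u < v → x + u < y + v
  +-mono-< {y = y} {u} x<y u<v = <-trans (+-monoˡ-< u x<y) (+-monoʳ-< y u<v)

  +-cancelʳ-< : ∀ z {x y} → x + z < y + z → x < y
  +-cancelʳ-< z {x} {y} lt =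
    <-respˡ (+-cancelʳ′ x z) (<-respʳ (+-cancelʳ′ y z) (+-monoˡ-< (- z) lt))

  +-monoˡ-≤ : ∀ z {x y} → x ≤ y → x + z ≤ y + z
  +-monoˡ-≤ z x≤y = x≤y ∘ +-cancelʳ-< z

  +-monoʳ-≤ : ∀ z {x y} → x ≤ y → z + x ≤ z + y
  +-monoʳ-≤ z {x} {y} x≤y =
    ≤-trans (≤-reflexive (+-comm z x)) (≤-trans (+-monoˡ-≤ z x≤y) (≤-reflexive (+-comm y z)))

  +-mono-≤ : ∀ {x y u v} → x ≤ y → u ≤ v → x + u ≤ y + v
  +-mono-≤ {y = y} {u} x≤y u≤v = ≤-trans (+-monoˡ-≤ u x≤y) (+-monoʳ-≤ y u≤v)

  x<x+d : ∀ x {d} → 0# < d → x < x + d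
  x<x+d x 0<d = <-respˡ (+-identityʳ x) (+-monoʳ-< x 0<d)

  x≤x+d : ∀ x {d} → 0# ≤ d → x ≤ x + d
  x≤x+d x 0≤d = ≤-trans (≤-reflexive (sym (+-identityʳ x))) (+-monoʳ-≤ x 0≤d)

  +-pos : ∀ {x y} → 0# < x → 0# < y → 0# < x + y
  +-pos {x} 0<x 0<y = <-trans 0<x (x<x+d x 0<y)

  difference : ∀ {x y} → x < y → ∃ λ d → 0# < d × y ≈ x + d
  difference {x} {y} x<y = y + - x
    , <-respˡ (-‿inverseʳ x) (+-monoˡ-< (- x) x<y)
    , sym (trans (sym (+-assoc x y (- x))) (trans (+-congʳ (+-comm x y)) (+-cancelʳ′ y x)))

  *-monoˡ-< : ∀ {z x y} → 0# < z → x < y → x * z < y * z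
  *-monoˡ-< {z} {x} {y} 0<z x<y with difference x<y
  ... | d , 0<d , y≈x+d = <-respʳ (sym (trans (*-congʳ y≈x+d) (distribʳ z x d)))
                            (x<x+d (x * z) (*-pos 0<d 0<z))

  *-monoʳ-< : ∀ {z x y} → 0# < z → x < y → z * x < z * y
  *-monoʳ-< {z} {x} {y} 0<z x<y =
    <-respˡ (*-comm x z) (<-respʳ (*-comm y z) (*-monoˡ-< 0<z x<y))

  inverse : ∀ {z} → 0# < z → ∃ λ w → 0# < w × z * w ≈ 1#
  inverse {z} 0<z = w , 0<w , zw≈1
    where
    inv  = #⇒invertible (Equivalence.from #⇔<⊎> (inj₂ 0<z))
    w    = proj₁ inv
    wz≈1 : w * z ≈ 1#
    wz≈1 = trans (*-congˡ (sym (x-0≈x z))) (proj₁ (proj₂ inv))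
    zw≈1 : z * w ≈ 1#
    zw≈1 = trans (*-comm z w) wz≈1
    0<w : 0# < w
    0<w with Equivalence.to #⇔<⊎> (invertibleˡ⇒# {w} {0#} (z , trans (*-congˡ (x-0≈x w)) zw≈1))
    ... | inj₁ w<0 = contradiction 0<1
          (<-asym (<-respˡ wz≈1 (<-respʳ (zeroˡ z) (*-monoˡ-< 0<z w<0))))
    ... | inj₂ 0<w = 0<w

  *-cancelʳ-< : ∀ {z x y} → 0# < z → x * z < y * z → x < y
  *-cancelʳ-< {z} {x} {y} 0<z xz<yz with inverse 0<z
  ... | w , 0<w , zw≈1 = <-respˡ (undo x) (<-respʳ (undo y) (*-monoˡ-< 0<w xz<yz))
    where
    undo : ∀ u → u * z * w ≈ u
    undo u = trans (*-assoc u z w) (trans (*-congˡ zw≈1) (*-identityʳ u))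

  *-monoˡ-≤ : ∀ {z x y} → 0# < z → x ≤ y → x * z ≤ y * z
  *-monoˡ-≤ 0<z x≤y = x≤y ∘ *-cancelʳ-< 0<z

  *-monoʳ-≤ : ∀ {z x y} → 0# < z → x ≤ y → z * x ≤ z * y
  *-monoʳ-≤ {z} {x} {y} 0<z x≤y =
    ≤-trans (≤-reflexive (*-comm z x)) (≤-trans (*-monoˡ-≤ 0<z x≤y) (≤-reflexive (*-comm y z)))

  *-cancelʳ-≤ : ∀ {z x y} → 0# < z → x * z ≤ y * z → x ≤ y
  *-cancelʳ-≤ 0<z xz≤yz = xz≤yz ∘ *-monoˡ-< 0<z

  *-monoˡ-≤-nonneg : ∀ {z x y} → 0# ≤ z → x ≤ y → x * z ≤ y * z
  *-monoˡ-≤-nonneg {z} {x} {y} 0≤z x≤y = by-trichotomy 0# z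
    (λ 0<z → *-monoˡ-≤ 0<z x≤y)
    (λ 0≈z → <-irrefl (trans (vanish y 0≈z) (sym (vanish x 0≈z))))
    (λ z<0 → contradiction z<0 0≤z)
    where
    vanish : ∀ u → 0# ≈ z → u * z ≈ 0#
    vanish u 0≈z = trans (*-congˡ (sym 0≈z)) (zeroʳ u)

  *-nonneg : ∀ {x y} → 0# ≤ x → 0# ≤ y → 0# ≤ x * y
  *-nonneg {x} {y} 0≤x 0≤y = ≤-trans (≤-reflexive (sym (zeroˡ y))) (*-monoˡ-≤-nonneg 0≤y 0≤x)

  *-mono-≤ : ∀ {x y u v} → 0# < x → 0# < v → x ≤ y → u ≤ v → x * u ≤ y * v
  *-mono-≤ 0<x 0<v x≤y u≤v = ≤-trans (*-monoʳ-≤ 0<x u≤v) (*-monoˡ-≤ 0<v x≤y)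

  *-mono-< : ∀ {x y u v} → 0# < x → 0# < v → x < y → u < v → x * u < y * v
  *-mono-< 0<x 0<v x<y u<v = <-trans (*-monoʳ-< 0<x u<v) (*-monoˡ-< 0<v x<y)

  ^-pos : ∀ {x} → 0# < x → ∀ n → 0# < x ^ n
  ^-pos 0<x zero    = 0<1
  ^-pos 0<x (suc n) = *-pos 0<x (^-pos 0<x n)

  ^-monoˡ-≤ : ∀ {x y} → 0# < x → x ≤ y → ∀ n → x ^ n ≤ y ^ n
  ^-monoˡ-≤ 0<x x≤y zero    = ≤-reflexive refl
  ^-monoˡ-≤ 0<x x≤y (suc n) =
    *-mono-≤ 0<x (^-pos (<-≤-trans 0<x x≤y) n) x≤y (^-monoˡ-≤ 0<x x≤y n)

  fromℕ-nonneg : ∀ n → 0# ≤ fromℕ n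
  fromℕ-nonneg zero    = ≤-reflexive refl
  fromℕ-nonneg (suc n) = <⇒≤ (0<fromℕ-suc n)

  bernoulli : ∀ {h} → 0# ≤ h → ∀ n → 1# + fromℕ n * h ≤ (1# + h) ^ n
  bernoulli {h} 0≤h zero = ≤-reflexive (trans (+-congˡ (zeroˡ h)) (+-identityʳ 1#))
  bernoulli {h} 0≤h (suc n) = begin
    1# + (1# + fromℕ n) * h
      ≤⟨ x≤x+d _ (*-nonneg (fromℕ-nonneg n) (*-nonneg 0≤h 0≤h)) ⟩
    1# + (1# + fromℕ n) * h + fromℕ n * (h * h)
      ≈⟨ solve 2 (λ k x → con 1 :+ (con 1 :+ k) :* x :+ k :* (x :* x)
                       := (con 1 :+ x) :* (con 1 :+ k :* x)) refl (fromℕ n) h ⟩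
    (1# + h) * (1# + fromℕ n * h)
      ≤⟨ *-monoʳ-≤ (<-≤-trans 0<1 (x≤x+d 1# 0≤h)) (bernoulli 0≤h n) ⟩
    (1# + h) ^ suc n ∎
    where open ≤-Reasoning

  4* : Carrier → Carrier
  4* x = (x + x) + (x + x)

  4*-cancel-≤ : ∀ {x y} → 4* x ≤ 4* y → x ≤ y
  4*-cancel-≤ le y<x = le (+-mono-< 2y<2x 2y<2x)
    where 2y<2x = +-mono-< y<x y<x

  -- With b = a + d the right side exceeds the left by the square of d. Writing the larger number as
  -- the smaller plus d keeps the identity free of subtraction, and the factor 4 keeps it free of
  -- division.
  4*≤square : ∀ a b → 4* (a * b) ≤ (a + b) * (a + b)
  4*≤square a b = by-trichotomy a b
    (λ a<b → <-asym (increasing a<b))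
    (λ a≈b → <-irrefl (trans (*-cong (+-congˡ (sym a≈b)) (+-congˡ (sym a≈b)))
                        (trans (solve 1 (λ x → (x :+ x) :* (x :+ x)
                                            := (x :* x :+ x :* x) :+ (x :* x :+ x :* x)) refl a)
                               (4*-cong (*-congˡ a≈b)))))
    (λ b<a → <-asym (<-respˡ (4*-cong (*-comm b a))
                      (<-respʳ (*-cong (+-comm b a) (+-comm b a)) (increasing b<a))))
    where
    4*-cong : ∀ {x y} → x ≈ y → 4* x ≈ 4* y
    4*-cong x≈y = +-cong (+-cong x≈y x≈y) (+-cong x≈y x≈y)
    increasing : ∀ {a b} → a < b → 4* (a * b) < (a + b) * (a + b)
    increasing {a} {b} a<b with difference a<b
    ... | d , 0<d , b≈a+d =
      <-respˡ (sym (4*-cong (*-congˡ b≈a+d)))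
      (<-respʳ (trans
        (solve 2 (λ x y → let p = x :* (x :+ y) in
                  ((p :+ p) :+ (p :+ p)) :+ y :* y := (x :+ (x :+ y)) :* (x :+ (x :+ y))) refl a d)
        (sym (*-cong (+-congˡ b≈a+d) (+-congˡ b≈a+d))))
      (x<x+d _ (*-pos 0<d 0<d)))

-- Limits and the exponential of a midpoint

module Limits {c ℓ₁ ℓ₂ : Level} (R : RealNumberSystem c ℓ₁ ℓ₂) where
  open OrderedField R

  Eventually : ∀ {a} → (ℕ → Set a) → Set a
  Eventually P = ∃ λ N → ∀ n → N ℕ.≤ n → P n

  both : ∀ {a b} {P : ℕ → Set a} {Q : ℕ → Set b} →
    Eventually P → Eventually Q → Eventually (λ n → P n × Q n)
  both (M , p) (N , q) = M ℕ.⊔ N , λ n M⊔N≤n →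
    p n (ℕ.≤-trans (ℕ.m≤m⊔n M N) M⊔N≤n) , q n (ℕ.≤-trans (ℕ.m≤n⊔m M N) M⊔N≤n)

  eventually-map : ∀ {a b} {P : ℕ → Set a} {Q : ℕ → Set b} →
    (∀ n → P n → Q n) → Eventually P → Eventually Q
  eventually-map f (N , p) = N , λ n N≤n → f n (p n N≤n)

  converges-const : ∀ l → Converges (λ _ → l) l
  converges-const l ε 0<ε = 0 , λ _ _ → x<x+d l 0<ε , x<x+d l 0<ε

  converges-≤ : ∀ {s t x y} → Converges s x → Converges t y →
    Eventually (λ n → s n ≤ t n) → x ≤ y
  converges-≤ {s} {t} {x} {y} s→x t→y s≤t y<x with difference y<x
  ... | d , 0<d , x≈y+d with inverse (+-pos 0<1 0<1)
  ...   | h , 0<h , 2h≈1 with both s≤t (both (s→x ε 0<ε) (t→y ε 0<ε))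
    where
    ε   = d * h
    0<ε = *-pos 0<d 0<h
  ...     | N , at = ≤-reflexive (trans (+-assoc y ε ε) (trans (+-congˡ ε+ε≈d) (sym x≈y+d))) (begin-strict
      x            <⟨ proj₁ (proj₁ (proj₂ (at N ℕ.≤-refl))) ⟩
      s N + ε      ≤⟨ +-monoˡ-≤ ε (proj₁ (at N ℕ.≤-refl)) ⟩
      t N + ε      <⟨ +-monoˡ-< ε (proj₂ (proj₂ (proj₂ (at N ℕ.≤-refl)))) ⟩
      (y + ε) + ε  ∎)
    where
    open ≤-Reasoning
    ε = d * h
    ε+ε≈d : ε + ε ≈ d
    ε+ε≈d = trans (solve 2 (λ u v → u :* v :+ u :* v := u :* ((con 1 :+ con 1) :* v)) refl d h)
                  (trans (*-congˡ 2h≈1) (*-identityʳ d))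

  -- Positivity of the limits and, eventually, of the terms lets both one-sided estimates arise by
  -- multiplying inequalities, without absolute values.
  converges-* : ∀ {s t x y} → 0# < x → 0# < y →
    Eventually (λ n → 0# < s n) → Eventually (λ n → 0# < t n) →
    Converges s x → Converges t y → Converges (λ n → s n * t n) (x * y)
  converges-* {s} {t} {x} {y} 0<x 0<y 0<s 0<t s→x t→y ε 0<ε with inverse 0<K
    where
    -- The summand ε makes K larger than ε, so that δ = ε / K is below 1 and 3δ is below 3.
    0<K : 0# < (x + y) + (1# + 1# + 1#) + ε
    0<K = +-pos (+-pos (+-pos 0<x 0<y) (+-pos (+-pos 0<1 0<1) 0<1)) 0<ε
  ... | k , 0<k , Kk≈1 =
    eventually-map close (both (both 0<s 0<t) (both (s→x δ 0<δ) (t→y δ 0<δ)))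
    where
    open ≤-Reasoning
    δ = ε * k
    0<δ = *-pos 0<ε 0<k
    three = 1# + 1# + 1#
    split : ε ≈ δ * (x + y + three) + δ * ε
    split = trans (sym (*-identityʳ ε)) (trans (*-congˡ (sym Kk≈1))
      (solve 4 (λ e i p q → e :* ((p :+ q) :* i) := (e :* i) :* p :+ (e :* i) :* q)
             refl ε k (x + y + three) ε))
    δ<1 : δ < 1#
    δ<1 = <-respʳ Kk≈1 (*-monoˡ-< 0<k
      (<-respˡ (+-identityˡ ε) (+-monoˡ-< ε (+-pos (+-pos 0<x 0<y) (+-pos (+-pos 0<1 0<1) 0<1)))))
    -- δ was chosen so that δ (x + y) + 3 δ² stays below ε.
    small : ∀ {z} → z ≤ three * δ → δ * (x + y + z) < ε
    small {z} z≤3δ = begin-strict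
      δ * (x + y + z)              ≤⟨ *-monoʳ-≤ 0<δ (+-monoʳ-≤ _ z≤3δ) ⟩
      δ * (x + y + three * δ)      <⟨ *-monoʳ-< 0<δ (+-monoʳ-< _ (*-monoʳ-< (+-pos (+-pos 0<1 0<1) 0<1) δ<1)) ⟩
      δ * (x + y + three * 1#)     ≈⟨ *-congˡ (+-congˡ (*-identityʳ three)) ⟩
      δ * (x + y + three)          <⟨ x<x+d _ (*-pos 0<δ 0<ε) ⟩
      δ * (x + y + three) + δ * ε  ≈⟨ split ⟨
      ε                            ∎
    δ≤3δ : δ ≤ three * δ
    δ≤3δ = ≤-trans (x≤x+d δ (<⇒≤ (+-pos 0<δ 0<δ)))
      (≤-reflexive (solve 1 (λ d → d :+ (d :+ d) := (con 1 :+ con 1 :+ con 1) :* d) refl δ))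
    close : ∀ n →
      (0# < s n × 0# < t n) × ((x < s n + δ) × (s n < x + δ)) × ((y < t n + δ) × (t n < y + δ)) →
      (x * y < s n * t n + ε) × (s n * t n < x * y + ε)
    close n ((0<sₙ , 0<tₙ) , (x<s+δ , s<x+δ) , (y<t+δ , t<y+δ)) = lower , upper
      where
      lower : x * y < s n * t n + ε
      lower = begin-strict
        x * y                              <⟨ *-mono-< 0<x (+-pos 0<tₙ 0<δ) x<s+δ y<t+δ ⟩
        (s n + δ) * (t n + δ)              ≈⟨ solve 3 (λ a b d → (a :+ d) :* (b :+ d)
                                                  := a :* b :+ d :* (a :+ b :+ d)) refl (s n) (t n) δ ⟩
        s n * t n + δ * (s n + t n + δ)    ≤⟨ +-monoʳ-≤ _ (*-monoʳ-≤ 0<δ (+-monoˡ-≤ δ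
                                                (<⇒≤ (+-mono-< s<x+δ t<y+δ)))) ⟩
        s n * t n + δ * ((x + δ) + (y + δ) + δ)
          ≈⟨ +-congˡ (*-congˡ (solve 3 (λ a b d → (a :+ d) :+ (b :+ d) :+ d
               := a :+ b :+ (con 1 :+ con 1 :+ con 1) :* d) refl x y δ)) ⟩
        s n * t n + δ * (x + y + three * δ)  <⟨ +-monoʳ-< _ (small (≤-reflexive refl)) ⟩
        s n * t n + ε                      ∎
      upper : s n * t n < x * y + ε
      upper = begin-strict
        s n * t n                  <⟨ *-mono-< 0<sₙ (+-pos 0<y 0<δ) s<x+δ t<y+δ ⟩
        (x + δ) * (y + δ)          ≈⟨ solve 3 (λ a b d → (a :+ d) :* (b :+ d)
                                          := a :* b :+ d :* (a :+ b :+ d)) refl x y δ ⟩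
        x * y + δ * (x + y + δ)    <⟨ +-monoʳ-< _ (small δ≤3δ) ⟩
        x * y + ε                  ∎

  fromℕ-suc*reciprocal : ∀ n → fromℕ (suc n) * reciprocal-suc n ≈ 1#
  fromℕ-suc*reciprocal n = trans (*-comm _ _) (trans (*-congˡ (sym (x-0≈x _)))
    (proj₁ (proj₂ (#⇒invertible (Equivalence.from #⇔<⊎> (inj₂ (0<fromℕ-suc n)))))))

  0<reciprocal : ∀ n → 0# < reciprocal-suc n
  0<reciprocal n = *-cancelʳ-< (0<fromℕ-suc n)
    (<-respˡ (sym (zeroˡ _)) (<-respʳ (sym (trans (*-comm _ _) (fromℕ-suc*reciprocal n))) 0<1))

  fromℕ-mono-≤ : ∀ {m n} → m ℕ.≤ n → fromℕ m ≤ fromℕ n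
  fromℕ-mono-≤ {n = n} ℕ.z≤n = fromℕ-nonneg n
  fromℕ-mono-≤ (ℕ.s≤s m≤n) = +-monoʳ-≤ 1# (fromℕ-mono-≤ m≤n)

  eventually-small : ∀ y → Eventually (λ n → y * reciprocal-suc n < 1#)
  eventually-small y with archimedean y
  ... | N , y<N = N , λ n N≤n → <-respʳ (fromℕ-suc*reciprocal n)
    (*-monoˡ-< (0<reciprocal n) (<-≤-trans y<N (fromℕ-mono-≤ (ℕ.≤-trans N≤n (ℕ.n≤1+n n)))))

  base : Carrier → ℕ → Carrier
  base y n = 1# + y * reciprocal-suc n

  -- For negative y the factor 1 + y / m may fail to be positive while m is small; this is why the
  -- termwise estimates hold only eventually.
  0<base : ∀ y → Eventually (λ n → 0# < base y n)
  0<base y = eventually-map add-one (eventually-small (- y))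
    where
    add-one : ∀ n → - y * reciprocal-suc n < 1# → 0# < base y n
    add-one n lt = <-respˡ (-‿inverseˡ _)
      (+-monoˡ-< (y * reciprocal-suc n) (<-respˡ (sym (-‿distribˡ-* y _)) lt))

  base<2 : ∀ y → Eventually (λ n → base y n < 1# + 1#)
  base<2 y = eventually-map (λ n → +-monoʳ-< 1#) (eventually-small y)

  -- AM-GM for the factors 1 + y / m of the approximations (1 + y / m) ^ m;
  -- the m-th power turns the gain 1 + η / m into at least 1 + η.
  exp-midpoint : ∀ {x₀ x₁ x₂ y₀ y₁ y₂ η} → 0# < x₀ → 0# < x₁ → 0# < x₂ →
    y₀ IsLogOf x₀ → y₁ IsLogOf x₁ → y₂ IsLogOf x₂ →
    0# ≤ η → (y₀ + y₂) + 4* η ≤ y₁ + y₁ →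
    (x₀ * x₂) * (1# + η) ≤ x₁ * x₁
  exp-midpoint {x₀} {x₁} {x₂} {y₀} {y₁} {y₂} {η} 0<x₀ 0<x₁ 0<x₂ l₀ l₁ l₂ 0≤η gap =
    converges-≤
      (converges-* (*-pos 0<x₀ 0<x₂) 0<1+η
        (eventually-map (λ n p → *-pos (^-pos (proj₁ p) (suc n)) (^-pos (proj₂ p) (suc n)))
          (both (0<base y₀) (0<base y₂)))
        (0 , λ _ _ → 0<1+η)
        (converges-* 0<x₀ 0<x₂ (0<power y₀) (0<power y₂) l₀ l₂) (converges-const (1# + η)))
      (converges-* 0<x₁ 0<x₁ (0<power y₁) (0<power y₁) l₁ l₁)
      (eventually-map termwise
        (both (both (0<base y₀) (0<base y₂)) (both (base<2 y₀) (base<2 y₂))))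
    where
    open ≤-Reasoning
    0<1+η = <-≤-trans 0<1 (x≤x+d 1# 0≤η)
    0<power : ∀ y → Eventually (λ n → 0# < base y n ^ suc n)
    0<power y = eventually-map (λ n p → ^-pos p (suc n)) (0<base y)
    termwise : ∀ n →
      (0# < base y₀ n × 0# < base y₂ n) × (base y₀ n < 1# + 1#) × (base y₂ n < 1# + 1#) →
      base y₀ n ^ suc n * base y₂ n ^ suc n * (1# + η) ≤ base y₁ n ^ suc n * base y₁ n ^ suc n
    termwise n ((0<A , 0<B) , A<2 , B<2) = begin
      A ^ m * B ^ m * (1# + η)      ≈⟨ *-congˡ (+-congˡ mh≈η) ⟨
      A ^ m * B ^ m * (1# + fromℕ m * h)
        ≤⟨ *-monoʳ-≤ (*-pos (^-pos 0<A m) (^-pos 0<B m)) (bernoulli 0≤h m) ⟩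
      A ^ m * B ^ m * (1# + h) ^ m  ≈⟨ *-congʳ (^-distrib-* A B m) ⟨
      (A * B) ^ m * (1# + h) ^ m    ≈⟨ ^-distrib-* (A * B) (1# + h) m ⟨
      (A * B * (1# + h)) ^ m        ≤⟨ ^-monoˡ-≤ (*-pos (*-pos 0<A 0<B) 0<1+h) AB[1+h]≤CC m ⟩
      (C * C) ^ m                   ≈⟨ ^-distrib-* C C m ⟩
      C ^ m * C ^ m                 ∎
      where
      m = suc n
      A = base y₀ n
      B = base y₂ n
      C = base y₁ n
      w = reciprocal-suc n
      h = η * w
      0≤h : 0# ≤ h
      0≤h = *-nonneg 0≤η (<⇒≤ (0<reciprocal n))
      0<1+h = <-≤-trans 0<1 (x≤x+d 1# 0≤h)
      mh≈η : fromℕ m * h ≈ η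
      mh≈η = trans (solve 3 (λ a b d → a :* (b :* d) := b :* (a :* d)) refl (fromℕ m) η w)
        (trans (*-congˡ (fromℕ-suc*reciprocal n)) (*-identityʳ η))
      -- The 4 in `gap` originates here: A and B are below 2, so (A + B) h is at most 4h, which is
      -- 4η / m.
      [A+B][1+h]≤2C : (A + B) * (1# + h) ≤ C + C
      [A+B][1+h]≤2C = begin
        (A + B) * (1# + h)        ≈⟨ trans (distribˡ _ _ _) (+-congʳ (*-identityʳ _)) ⟩
        (A + B) + (A + B) * h     ≤⟨ +-monoʳ-≤ _ (*-monoˡ-≤-nonneg 0≤h (<⇒≤ (+-mono-< A<2 B<2))) ⟩
        (A + B) + ((1# + 1#) + (1# + 1#)) * h
          ≈⟨ solve 4 (λ a b e v → (con 1 :+ a :* v) :+ (con 1 :+ b :* v)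
                :+ ((con 1 :+ con 1) :+ (con 1 :+ con 1)) :* (e :* v)
               := (con 1 :+ con 1) :+ ((a :+ b) :+ ((e :+ e) :+ (e :+ e))) :* v) refl y₀ y₂ η w ⟩
        (1# + 1#) + ((y₀ + y₂) + 4* η) * w  ≤⟨ +-monoʳ-≤ _ (*-monoˡ-≤ (0<reciprocal n) gap) ⟩
        (1# + 1#) + (y₁ + y₁) * w
          ≈⟨ solve 2 (λ a v → (con 1 :+ con 1) :+ (a :+ a) :* v
               := (con 1 :+ a :* v) :+ (con 1 :+ a :* v)) refl y₁ w ⟩
        C + C                     ∎
      0<[A+B][1+h] = *-pos (+-pos 0<A 0<B) 0<1+h
      -- A second factor 1 + h is inserted to complete the square of (A + B)(1 + h), which is then
      -- compared with the square of 2C. That 2C is positive follows from the same bound.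
      AB[1+h]≤CC : A * B * (1# + h) ≤ C * C
      AB[1+h]≤CC = 4*-cancel-≤ (begin
        4* (A * B * (1# + h))      ≈⟨ solve 2 (λ a e → (a :* e :+ a :* e) :+ (a :* e :+ a :* e)
                                         := ((a :+ a) :+ (a :+ a)) :* e) refl (A * B) (1# + h) ⟩
        4* (A * B) * (1# + h)      ≤⟨ *-monoˡ-≤ 0<1+h (4*≤square A B) ⟩
        (A + B) * (A + B) * (1# + h)
          ≤⟨ x≤x+d _ (*-nonneg (<⇒≤ (*-pos (*-pos (+-pos 0<A 0<B) (+-pos 0<A 0<B)) 0<1+h)) 0≤h) ⟩
        (A + B) * (A + B) * (1# + h) + (A + B) * (A + B) * (1# + h) * h
          ≈⟨ solve 2 (λ s e → s :* s :* (con 1 :+ e) :+ s :* s :* (con 1 :+ e) :* e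
               := (s :* (con 1 :+ e)) :* (s :* (con 1 :+ e))) refl (A + B) h ⟩
        ((A + B) * (1# + h)) * ((A + B) * (1# + h))
          ≤⟨ *-mono-≤ 0<[A+B][1+h] (<-≤-trans 0<[A+B][1+h] [A+B][1+h]≤2C)
               [A+B][1+h]≤2C [A+B][1+h]≤2C ⟩
        (C + C) * (C + C)
          ≈⟨ solve 1 (λ z → (z :+ z) :* (z :+ z) := (z :* z :+ z :* z) :+ (z :* z :+ z :* z)) refl C ⟩
        4* (C * C)                 ∎)

-- Log-concavity at consecutive integers

module Midpoints {c ℓ₁ ℓ₂ : Level} (R : RealNumberSystem c ℓ₁ ℓ₂) where
  open OrderedField R
  open Limits R

  module _ {f : Carrier → Carrier} (f⁺ : IsPositiveFunction f) where
    private module f⁺ = IsPositiveFunction f⁺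

    1≤fromℕ-suc : ∀ k → 1# ≤ fromℕ (suc k)
    1≤fromℕ-suc k = x≤x+d 1# (fromℕ-nonneg k)

    fromℕ-suc-pos : ∀ k → 0# < f (fromℕ (suc k))
    fromℕ-suc-pos k = f⁺.positive (1≤fromℕ-suc k)

    private
      half-inverse = inverse (+-pos 0<1 0<1)
      ½ = proj₁ half-inverse
      0<½ : 0# < ½
      0<½ = proj₁ (proj₂ half-inverse)
      ½+½≈1 : ½ + ½ ≈ 1#
      ½+½≈1 = trans (solve 1 (λ t → t :+ t := (con 1 :+ con 1) :* t) refl ½) (proj₂ (proj₂ half-inverse))
      ½<1 : ½ < 1#
      ½<1 = <-respʳ ½+½≈1 (x<x+d ½ 0<½)
      1-½≈½ : 1# - ½ ≈ ½
      1-½≈½ = trans (+-congʳ (sym ½+½≈1)) (+-cancelʳ′ ½ ½)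

      -- The unsimplified form is the one that `Concave` produces. Only `f` comes with a congruence
      -- law, so `g` stays at this term and the value of `f` is moved to k + 2 instead.
      midpoint : ℕ → Carrier
      midpoint k = ½ * fromℕ (suc k) + (1# - ½) * fromℕ (3 ℕ.+ k)

      midpoint≈ : ∀ k → midpoint k ≈ fromℕ (2 ℕ.+ k)
      midpoint≈ k = trans (+-congˡ (*-congʳ 1-½≈½))
        (trans (solve 2 (λ t x → t :* x :+ t :* (con 1 :+ (con 1 :+ x)) := (t :+ t) :* (con 1 :+ x))
                        refl ½ (fromℕ (suc k)))
               (trans (*-congʳ ½+½≈1) (*-identityˡ _)))

      1≤midpoint : ∀ k → 1# ≤ midpoint k
      1≤midpoint k = ≤-trans (1≤fromℕ-suc (suc k)) (≤-reflexive (sym (midpoint≈ k)))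

      -- Serves both versions: d = 0 gives the weak inequality, and the positive d contained in
      -- strict concavity leaves the factor 1 + d / 2, which makes the inequality strict after the
      -- limit.
      gap⇒midpoint : ∀ {g d} → g IsLogFunctionOf f → ∀ k → 0# ≤ d →
        ½ * g (fromℕ (suc k)) + (1# - ½) * g (fromℕ (3 ℕ.+ k)) + d ≤ g (midpoint k) →
        f (fromℕ (suc k)) * f (fromℕ (3 ℕ.+ k)) * (1# + d * ½)
          ≤ f (fromℕ (2 ℕ.+ k)) * f (fromℕ (2 ℕ.+ k))
      gap⇒midpoint {g} {d} log k 0≤d gap =
        ≤-trans (exp-midpoint (fromℕ-suc-pos k) (f⁺.positive (1≤midpoint k)) (fromℕ-suc-pos (2 ℕ.+ k))
                  (log _ (1≤fromℕ-suc k)) (log _ (1≤midpoint k)) (log _ (1≤fromℕ-suc (2 ℕ.+ k)))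
                  (*-nonneg 0≤d (<⇒≤ 0<½)) doubled)
                (≤-reflexive (*-cong f-mid f-mid))
        where
        open ≤-Reasoning
        f-mid = f⁺.cong (1≤midpoint k) (1≤fromℕ-suc (suc k)) (midpoint≈ k)
        y₀ = g (fromℕ (suc k))
        y₂ = g (fromℕ (3 ℕ.+ k))
        -- Doubling the concavity inequality gives the gap 2d, which is four times d / 2; hence η =
        -- d / 2.
        doubled : (y₀ + y₂) + 4* (d * ½) ≤ g (midpoint k) + g (midpoint k)
        doubled = begin
          (y₀ + y₂) + 4* (d * ½)
            ≈⟨ +-congʳ (trans (*-congʳ ½+½≈1) (*-identityˡ (y₀ + y₂))) ⟨
          (½ + ½) * (y₀ + y₂) + 4* (d * ½)
            ≈⟨ solve 4 (λ t a b e → (t :+ t) :* (a :+ b) :+ ((e :* t :+ e :* t) :+ (e :* t :+ e :* t))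
                 := (t :* a :+ t :* b :+ e :* (t :+ t)) :+ (t :* a :+ t :* b :+ e :* (t :+ t))) refl ½ y₀ y₂ d ⟩
          (½ * y₀ + ½ * y₂ + d * (½ + ½)) + (½ * y₀ + ½ * y₂ + d * (½ + ½))
            ≈⟨ +-cong shape shape ⟩
          _ ≤⟨ +-mono-≤ gap gap ⟩
          g (midpoint k) + g (midpoint k) ∎
          where
          shape : ½ * y₀ + ½ * y₂ + d * (½ + ½) ≈ ½ * y₀ + (1# - ½) * y₂ + d
          shape = +-cong (+-congˡ (*-congʳ (sym 1-½≈½))) (trans (*-congˡ ½+½≈1) (*-identityʳ d))

    logConcave⇒midpoint : LogConcave f → ∀ k →
      f (fromℕ (suc k)) * f (fromℕ (3 ℕ.+ k)) ≤ f (fromℕ (2 ℕ.+ k)) * f (fromℕ (2 ℕ.+ k))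
    logConcave⇒midpoint (g , log , concave) k = ≤-trans
      (≤-reflexive (sym (trans (*-congˡ (trans (+-congˡ (zeroˡ ½)) (+-identityʳ 1#))) (*-identityʳ _))))
      (gap⇒midpoint log k (≤-reflexive refl)
        (≤-trans (≤-reflexive (+-identityʳ _))
          (concave _ _ ½ (1≤fromℕ-suc k) (1≤fromℕ-suc (2 ℕ.+ k)) (<⇒≤ 0<½) (<⇒≤ ½<1))))

    strictlyLogConcave⇒midpoint : StrictlyLogConcave f → ∀ k →
      f (fromℕ (suc k)) * f (fromℕ (3 ℕ.+ k)) < f (fromℕ (2 ℕ.+ k)) * f (fromℕ (2 ℕ.+ k))
    strictlyLogConcave⇒midpoint (g , log , concave) k with difference
      (concave _ _ ½ (1≤fromℕ-suc k) (1≤fromℕ-suc (2 ℕ.+ k)) (Equivalence.from #⇔<⊎> (inj₁ k+1<k+3)) 0<½ ½<1)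
      where
      k+1<k+3 : fromℕ (suc k) < fromℕ (3 ℕ.+ k)
      k+1<k+3 = <-respʳ (solve 1 (λ x → x :+ (con 1 :+ con 1) := con 1 :+ (con 1 :+ x)) refl _)
        (x<x+d (fromℕ (suc k)) (+-pos 0<1 0<1))
    ... | d , 0<d , gap = <-≤-trans
      (<-respˡ (*-identityʳ _) (*-monoʳ-< (*-pos (fromℕ-suc-pos k) (fromℕ-suc-pos (2 ℕ.+ k)))
        (x<x+d 1# (*-pos 0<d 0<½))))
      (gap⇒midpoint log k (<⇒≤ 0<d) (≤-reflexive (sym gap)))

-- Spreading a sequence of natural numbers

module Spreading where
  open import Data.Nat.Base using (_+_; _<_; _≤_)

  infix 4 _⊒_
  -- In `spread` both amounts above x are successors, so the move is never a mere rearrangement.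
  -- Degenerate moves fall under `perm`. A derivation therefore either permutes the list or, for
  -- strictly log-concave weights, strictly lowers the product.
  data _⊒_ : List ℕ → List ℕ → Set where
    perm    : ∀ {xs ys} → xs ↭ ys → xs ⊒ ys
    cons    : ∀ x {xs ys} → xs ⊒ ys → x ∷ xs ⊒ x ∷ ys
    ⊒-trans : ∀ {xs ys zs} → xs ⊒ ys → ys ⊒ zs → xs ⊒ zs
    spread  : ∀ x j k {xs} →
              x + suc j ∷ x + suc k ∷ xs ⊒ x ∷ x + (suc j + suc k) ∷ xs

  ⊒-length : ∀ {xs ys} → xs ⊒ ys → length xs ≡ length ys
  ⊒-length (perm p)       = ↭-length p
  ⊒-length (cons x d)     = ≡.cong suc (⊒-length d)
  ⊒-length (⊒-trans d e)  = ≡.trans (⊒-length d) (⊒-length e)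
  ⊒-length (spread x j k) = ≡.refl

  ⊒-sum : ∀ {xs ys} → xs ⊒ ys → sum xs ≡ sum ys
  ⊒-sum (perm p)       = sum-↭ p
  ⊒-sum (cons x d)     = ≡.cong (x +_) (⊒-sum d)
  ⊒-sum (⊒-trans d e)  = ≡.trans (⊒-sum d) (⊒-sum e)
  ⊒-sum (spread x j k {xs}) = regroup x (suc j) (suc k) (sum xs)
    where
    open ℕ.+-*-Solver
    regroup : ∀ x j k s → x + j + (x + k + s) ≡ x + (x + (j + k) + s)
    regroup = solve 4 (λ x j k s → x :+ j :+ (x :+ k :+ s) := x :+ (x :+ (j :+ k) :+ s)) ≡.refl

  merge-two : ∀ a b xs → a ∷ b ∷ xs ⊒ 0 ∷ a + b ∷ xs
  merge-two zero    b       xs = perm ↭-refl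
  merge-two (suc a) zero    xs rewrite ℕ.+-identityʳ a = perm (swap _ _ ↭-refl)
  merge-two (suc a) (suc b) xs = spread 0 a b

  absorb : ∀ b xs → b ∷ xs ⊒ (b + sum xs) ∷ replicate (length xs) 0
  absorb b [] rewrite ℕ.+-identityʳ b = perm ↭-refl
  absorb b (e ∷ es) = ⊒-trans (merge-two b e es)
    (⊒-trans (cons 0 (absorb (b + e) es))
      (perm (≡.subst (λ t → 0 ∷ b + e + sum es ∷ replicate (length es) 0 ↭ t ∷ replicate (suc (length es)) 0)
        (ℕ.+-assoc b e (sum es)) (swap _ _ ↭-refl))))

  merge-two-above-1 : ∀ a b xs → suc a ∷ suc b ∷ xs ⊒ 1 ∷ suc (a + b) ∷ xs
  merge-two-above-1 zero    b       xs = perm ↭-refl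
  merge-two-above-1 (suc a) zero    xs rewrite ℕ.+-identityʳ a = perm (swap _ _ ↭-refl)
  merge-two-above-1 (suc a) (suc b) xs = spread 1 a b

  -- The last merge takes place above 1 instead of 0: a third entry has to stay positive, as it does
  -- in every list of indegrees, so one unit is left in it.
  concentrate₂ : ∀ D b c xs →
    ∃ λ N → D ∷ suc b ∷ suc c ∷ xs ⊒ D ∷ suc N ∷ 1 ∷ replicate (length xs) 0
  concentrate₂ D b c xs = b + (c + sum xs) , cons D
    (⊒-trans (cons (suc b) (absorb (suc c) xs))
      (⊒-trans (merge-two-above-1 b (c + sum xs) _) (perm (swap _ _ ↭-refl))))

  -- The extra 0 leaves room for r even when every entry equals D.
  concentrate : ∀ {D} xs → 0 < D → All (_≤ D) xs →
    ∃ λ q → ∃₂ λ r j → r < D × 0 ∷ xs ⊒ r ∷ replicate q D ++ replicate j 0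
  concentrate [] 0<D [] = 0 , 0 , 0 , 0<D , perm ↭-refl
  concentrate {D} (d ∷ xs) 0<D (d≤D ∷ xs≤D) with concentrate xs 0<D xs≤D
  ... | q , r , j , r<D , 0∷xs⊒ = step (d + r ℕ.<? D)
    where
    tl = replicate q D ++ replicate j 0
    expose : 0 ∷ d ∷ xs ⊒ d ∷ r ∷ tl
    expose = ⊒-trans (perm (swap _ _ ↭-refl)) (cons d 0∷xs⊒)

    Result = ∃ λ q → ∃₂ λ r j → r < D × 0 ∷ d ∷ xs ⊒ r ∷ replicate q D ++ replicate j 0

    overflow : D ≤ d + r → Result
    overflow D≤d+r with ℕ.m≤n⇒m<n∨m≡n d≤D
    ... | inj₂ ≡.refl = suc q , r , j , r<D , ⊒-trans expose (perm (swap _ _ ↭-refl))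
    -- Since d + r = x + D, the entries are d = x + (D - r) and r = x + (D - d). Both differences
    -- are positive, and spreading from the base x fills one entry up to D and leaves x as the new
    -- remainder.
    ... | inj₁ d<D = suc q , x , j , x<D , ⊒-trans expose
        (≡.subst₂ _⊒_ (≡.cong₂ (λ u v → u ∷ v ∷ tl) (≡.sym d≡) (≡.sym r≡))
          (≡.cong (λ u → x ∷ u ∷ tl) (≡.sym D≡)) (spread x s k))
      where
      x = d + r ∸ D
      s = D ∸ suc r
      k = D ∸ suc d
      x<D : x < D
      x<D = ℕ.+-cancelʳ-< D x D (≡.subst (_< D + D) (≡.sym (ℕ.m∸n+n≡m D≤d+r)) (ℕ.+-mono-< d<D r<D))
      D≡r : suc r + s ≡ D
      D≡r = ℕ.m+[n∸m]≡n r<D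
      D≡d : suc d + k ≡ D
      D≡d = ℕ.m+[n∸m]≡n d<D
      x+D : x + D ≡ d + r
      x+D = ℕ.m∸n+n≡m D≤d+r
      d≡ : d ≡ x + suc s
      d≡ = ℕ.+-cancelʳ-≡ r d (x + suc s) (≡.trans (≡.sym x+D) (≡.trans (≡.cong (x +_)
        (≡.trans (≡.sym D≡r) (≡.cong suc (ℕ.+-comm r s)))) (≡.sym (ℕ.+-assoc x (suc s) r))))
      r≡ : r ≡ x + suc k
      r≡ = ℕ.+-cancelʳ-≡ d r (x + suc k) (≡.trans (ℕ.+-comm r d) (≡.trans (≡.sym x+D) (≡.trans (≡.cong (x +_)
        (≡.trans (≡.sym D≡d) (≡.cong suc (ℕ.+-comm d k)))) (≡.sym (ℕ.+-assoc x (suc k) d)))))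
      D≡ : D ≡ x + (suc s + suc k)
      D≡ = ≡.trans (≡.sym D≡d) (≡.trans (≡.sym (ℕ.+-suc d k)) (≡.trans (≡.cong (_+ suc k) d≡)
        (ℕ.+-assoc x (suc s) (suc k))))

    step : Dec (d + r < D) → Result
    step (yes d+r<D) = q , d + r , suc j , d+r<D ,
      ⊒-trans expose (⊒-trans (merge-two d r tl)
        (⊒-trans (perm (swap _ _ ↭-refl)) (cons (d + r) (perm (↭-sym (shift 0 (replicate q D) (replicate j 0)))))))
    step (no d+r≮D) = overflow (ℕ.≮⇒≥ d+r≮D)

open Spreading

-- Log-concave weights along spreading moves

module WeightedProducts {c ℓ₁ ℓ₂ : Level} (R : RealNumberSystem c ℓ₁ ℓ₂) where
  open OrderedField R

  module Weights
    (Ψ : ℕ → Carrier) (0<Ψ : ∀ k → 0# < Ψ k)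
    (midpoint-≤ : ∀ k → Ψ k * Ψ (2 ℕ.+ k) ≤ Ψ (1 ℕ.+ k) * Ψ (1 ℕ.+ k))
    where

    private
      0<ΨΨ : ∀ a b → 0# < Ψ a * Ψ b
      0<ΨΨ a b = *-pos (0<Ψ a) (0<Ψ b)

      regroup : ∀ a b c e → (a * e) * (b * c) ≈ (a * b) * (c * e)
      regroup = solve 4 (λ a b c e → (a :* e) :* (b :* c) := (a :* b) :* (c :* e)) refl

      regroup′ : ∀ b c d g → (c * d) * (g * b) ≈ (g * d) * (b * c)
      regroup′ = solve 4 (λ b c d g → (c :* d) :* (g :* b) := (g :* d) :* (b :* c)) refl

    -- Ratios compared by cross-multiplication: a / d ≤ c / b and c / g ≤ b / e
    -- give a / d ≤ g / e.
    ratio-≤ : ∀ a b c d e g →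
      Ψ a * Ψ b ≤ Ψ c * Ψ d → Ψ c * Ψ e ≤ Ψ g * Ψ b → Ψ a * Ψ e ≤ Ψ g * Ψ d
    ratio-≤ a b c d e g ab≤cd ce≤gb = *-cancelʳ-≤ (0<ΨΨ b c)
      (≤-trans (≤-reflexive (regroup _ _ _ _))
        (≤-trans (*-mono-≤ (0<ΨΨ a b) (0<ΨΨ g b) ab≤cd ce≤gb) (≤-reflexive (regroup′ _ _ _ _))))

    ratio-< : ∀ a b c d e g →
      Ψ a * Ψ b ≤ Ψ c * Ψ d → Ψ c * Ψ e < Ψ g * Ψ b → Ψ a * Ψ e < Ψ g * Ψ d
    ratio-< a b c d e g ab≤cd ce<gb = *-cancelʳ-< (0<ΨΨ b c)
      (<-respˡ (sym (regroup _ _ _ _)) (<-respʳ (regroup′ _ _ _ _)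
        (≤-<-trans (*-monoˡ-≤ (0<ΨΨ c e) ab≤cd) (*-monoʳ-< (0<ΨΨ c d) ce<gb))))

    -- The ratio of Ψ (i + 1) to Ψ i does not increase with i: `midpoint-≤` compares neighbouring
    -- ratios, and induction on k chains these comparisons from x to k + x.
    shift-one-≤ : ∀ x k → Ψ x * Ψ (suc (k ℕ.+ x)) ≤ Ψ (k ℕ.+ x) * Ψ (suc x)
    shift-one-≤ x zero    = ≤-reflexive refl
    shift-one-≤ x (suc k) = ratio-≤ x (suc (k ℕ.+ x)) (k ℕ.+ x) (suc x) (2 ℕ.+ (k ℕ.+ x)) (suc (k ℕ.+ x))
      (shift-one-≤ x k) (midpoint-≤ (k ℕ.+ x))

    -- Raising j by one multiplies the sides by the ratios at j + k + x and at j + x, which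
    -- `shift-one-≤` compares.
    shift-≤ : ∀ x j k → Ψ x * Ψ (j ℕ.+ (k ℕ.+ x)) ≤ Ψ (j ℕ.+ x) * Ψ (k ℕ.+ x)
    shift-≤ x zero    k = ≤-reflexive refl
    shift-≤ x (suc j) k = ratio-≤ x (j ℕ.+ (k ℕ.+ x)) (j ℕ.+ x) (k ℕ.+ x) (suc (j ℕ.+ (k ℕ.+ x))) (suc (j ℕ.+ x))
      (shift-≤ x j k)
      (≤-trans (≤-reflexive (*-congˡ (reflexive (≡.cong (λ i → Ψ (suc i)) j+[k+x]≡))))
        (≤-trans (shift-one-≤ (j ℕ.+ x) k)
          (≤-reflexive (trans (*-comm _ _) (*-congˡ (reflexive (≡.cong Ψ (≡.sym j+[k+x]≡))))))))
      where
      j+[k+x]≡ : j ℕ.+ (k ℕ.+ x) ≡ k ℕ.+ (j ℕ.+ x)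
      j+[k+x]≡ = ≡.trans (≡.sym (ℕ.+-assoc j k x)) (≡.trans (≡.cong (ℕ._+ x) (ℕ.+-comm j k)) (ℕ.+-assoc k j x))

    weight : List ℕ → Carrier
    weight = foldr (λ k w → Ψ k * w) 1#

    weight-pos : ∀ xs → 0# < weight xs
    weight-pos []       = 0<1
    weight-pos (x ∷ xs) = *-pos (0<Ψ x) (weight-pos xs)

    weight-↭ : ∀ {xs ys} → xs ↭ ys → weight xs ≈ weight ys
    weight-↭ Perm.refl        = refl
    weight-↭ (prep x p)       = *-congˡ (weight-↭ p)
    weight-↭ (swap x y p)     = trans (sym (*-assoc _ _ _))
      (trans (*-cong (*-comm _ _) (weight-↭ p)) (*-assoc _ _ _))
    weight-↭ (Perm.trans p q) = trans (weight-↭ p) (weight-↭ q)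

    private
      spread-≡ : ∀ x j k →
        x ℕ.+ (j ℕ.+ k) ≡ j ℕ.+ (k ℕ.+ x)
      spread-≡ x j k = ≡.trans (ℕ.+-comm x (j ℕ.+ k)) (ℕ.+-assoc j k x)

    weight-≤ : ∀ {xs ys} → xs ⊒ ys → weight ys ≤ weight xs
    weight-≤ (perm p)      = ≤-reflexive (sym (weight-↭ p))
    weight-≤ (cons x d)    = *-monoʳ-≤ (0<Ψ x) (weight-≤ d)
    weight-≤ (⊒-trans d e) = ≤-trans (weight-≤ e) (weight-≤ d)
    weight-≤ (spread x j k {xs})
      rewrite spread-≡ x (suc j) (suc k) | ℕ.+-comm x (suc j) | ℕ.+-comm x (suc k) =
      ≤-trans (≤-reflexive (sym (*-assoc _ _ _)))
        (≤-trans (*-monoˡ-≤ (weight-pos xs) (shift-≤ x (suc j) (suc k))) (≤-reflexive (*-assoc _ _ _)))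

    module _ (midpoint-< : ∀ k → Ψ k * Ψ (2 ℕ.+ k) < Ψ (1 ℕ.+ k) * Ψ (1 ℕ.+ k)) where

      shift-one-< : ∀ x k → Ψ x * Ψ (suc (suc k ℕ.+ x)) < Ψ (suc k ℕ.+ x) * Ψ (suc x)
      shift-one-< x k = ratio-< x (suc (k ℕ.+ x)) (k ℕ.+ x) (suc x) (2 ℕ.+ (k ℕ.+ x)) (suc (k ℕ.+ x))
        (shift-one-≤ x k) (midpoint-< (k ℕ.+ x))

      -- One strict comparison is enough: the last increment of j supplies it, and `shift-≤` covers
      -- the others.
      shift-< : ∀ x j k → Ψ x * Ψ (suc j ℕ.+ (suc k ℕ.+ x)) < Ψ (suc j ℕ.+ x) * Ψ (suc k ℕ.+ x)
      shift-< x j k = ratio-< x (j ℕ.+ (suc k ℕ.+ x)) (j ℕ.+ x) (suc k ℕ.+ x) (suc (j ℕ.+ (suc k ℕ.+ x))) (suc (j ℕ.+ x))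
        (shift-≤ x j (suc k))
        (<-respˡ (*-congˡ (reflexive (≡.cong (λ i → Ψ (suc i)) (≡.sym eq))))
          (<-respʳ (trans (*-comm _ _) (*-congˡ (reflexive (≡.cong Ψ (≡.sym eq)))))
            (shift-one-< (j ℕ.+ x) k)))
        where
        eq : j ℕ.+ (suc k ℕ.+ x) ≡ suc k ℕ.+ (j ℕ.+ x)
        eq = ≡.trans (≡.sym (ℕ.+-assoc j (suc k) x)) (≡.trans (≡.cong (ℕ._+ x) (ℕ.+-comm j (suc k))) (ℕ.+-assoc (suc k) j x))

      weight-< : ∀ {xs ys} → xs ⊒ ys → xs ↭ ys ⊎ weight ys < weight xs
      weight-< (perm p)   = inj₁ p
      weight-< (cons x d) with weight-< d
      ... | inj₁ p  = inj₁ (prep x p)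
      ... | inj₂ lt = inj₂ (*-monoʳ-< (0<Ψ x) lt)
      weight-< (⊒-trans d e) with weight-< d | weight-< e
      ... | inj₁ p  | inj₁ q   = inj₁ (↭-trans p q)
      ... | inj₂ lt | _        = inj₂ (≤-<-trans (weight-≤ e) lt)
      ... | inj₁ _  | inj₂ lt  = inj₂ (<-≤-trans lt (weight-≤ d))
      weight-< (spread x j k {xs})
        rewrite spread-≡ x (suc j) (suc k) | ℕ.+-comm x (suc j) | ℕ.+-comm x (suc k) =
        inj₂ (<-respˡ (*-assoc _ _ _) (<-respʳ (*-assoc _ _ _)
          (*-monoˡ-< (weight-pos xs) (shift-< x j k))))

-- Orienting a unicyclic graph

module Orientations where
  open import Data.Nat.Base using (_+_)
  open ≡ using (refl; sym; trans; cong; cong₂; subst; module ≡-Reasoning)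

  least : ∀ {P : ℕ → Set} → Decidable P → ∀ {k} → P k → ∃ λ m → P m × (∀ {j} → P j → m ℕ.≤ j)
  least P? {k} Pk with P? 0
  least P? {k}     Pk | yes P0 = 0 , P0 , λ _ → z≤n
  least P? {zero}  Pk | no ¬P0 = contradiction Pk ¬P0
  least {P} P? {suc k} Pk | no ¬P0 with least (P? ∘ suc) Pk
  ... | m , Pm , m-min = suc m , Pm , λ { {zero} P0 → contradiction P0 ¬P0 ; {suc j} Pj → s≤s (m-min Pj) }

  module _ {n : ℕ} where

    -- Path R x z l: the walk x ∷ l ends in z.
    data Path (R : Rel (Fin n) 0ℓ) : Fin n → Fin n → List (Fin n) → Set where
      stop : ∀ {x} → Path R x x []
      step : ∀ {x y z l} → R x y → Path R y z l → Path R x z (y ∷ l)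

    SimplePath : Rel (Fin n) 0ℓ → Fin n → Fin n → Set
    SimplePath R x z = ∃ λ l → Path R x z l × Unique (x ∷ l)

    module _ {R : Rel (Fin n) 0ℓ} where

      suffix : ∀ {x y z l} → y ∈ x ∷ l → Path R x z l → Unique (x ∷ l) → SimplePath R y z
      suffix (here refl) p          u       = _ , p , u
      suffix (there y∈l) (step _ p) (_ ∷ u) = suffix y∈l p u

      -- Loop erasure: if x recurs on the simple path from y, everything before that occurrence is
      -- dropped.
      simplePath : ∀ {x z} → Star R x z → SimplePath R x z
      simplePath Star.ε = [] , stop , [] ∷ []
      simplePath {x} (_◅_ {j = y} r rs) with simplePath rs
      ... | l , p , u with x ∈? y ∷ l
        where open import Data.List.Membership.DecPropositional _≟_ using (_∈?_)
      ...   | yes x∈ = suffix x∈ p u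
      ...   | no  x∉ = y ∷ l , step r p , All.¬Any⇒All¬ _ x∉ ∷ u

      close : ∀ {x z w l} → Path R x z l → R z w → Linked R (x ∷ l ∷ʳ w)
      close stop       r = r ∷ [-]
      close (step q p) r = q ∷ close p r

      linked⇒consecutive : ∀ ys {u v zs} → Linked R (ys ++ u ∷ v ∷ zs) → R u v
      linked⇒consecutive []           (r ∷ _)  = r
      linked⇒consecutive (y ∷ [])     (_ ∷ rs) = linked⇒consecutive [] rs
      linked⇒consecutive (y ∷ x ∷ ys) (_ ∷ rs) = linked⇒consecutive (x ∷ ys) rs

  -- Every edge joins u to `next u` for exactly one of its ends u: `covers` provides such an end,
  -- and `no-return` prevents both ends from qualifying.
  record Orientation {n : ℕ} (G : Graph n) : Set where
    open Graph G
    field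
      next      : Fin n → Fin n
      ~-next    : ∀ u → u ~ next u
      covers    : ∀ {u v} → u ~ v → next u ≡ v ⊎ next v ≡ u
      no-return : ∀ u → next (next u) ≢ u

  -- For an edge ab of the only cycle, its deletion leaves a tree. Rooted at a, the tree sends each
  -- other vertex to a neighbour closer to a, and a itself is sent to b. The tree path from b to a
  -- is the rest of the cycle, so the cycle becomes cyclically oriented.
  module Orient {n : ℕ} (G : Graph n) (a b : Fin n) (a~b : Graph._~_ G a b) where
    open Graph G

    infix 4 _~′_
    _~′_ : Rel (Fin n) 0ℓ
    u ~′ v = u ~ v × ¬ (u ≡ a × v ≡ b) × ¬ (u ≡ b × v ≡ a)

    ~′-sym : Symmetric _~′_
    ~′-sym (u~v , ¬ab , ¬ba) =
      ~-sym u~v , (λ (v≡a , u≡b) → ¬ba (u≡b , v≡a)) , (λ (v≡b , u≡a) → ¬ab (u≡a , v≡b))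

    _~′?_ : ∀ u v → Dec (u ~′ v)
    u ~′? v = (u ~? v) ×-dec ¬? (u ≟ a ×-dec v ≟ b) ×-dec ¬? (u ≟ b ×-dec v ≟ a)

    ab-or-~′ : ∀ {u v} → u ~ v → (u ≡ a × v ≡ b) ⊎ (u ≡ b × v ≡ a) ⊎ u ~′ v
    ab-or-~′ {u} {v} u~v with u ≟ a ×-dec v ≟ b | u ≟ b ×-dec v ≟ a
    ... | yes ab | _      = inj₁ ab
    ... | no _   | yes ba = inj₂ (inj₁ ba)
    ... | no ¬ab | no ¬ba = inj₂ (inj₂ (u~v , ¬ab , ¬ba))

    -- An edge whose first end is neither a nor b survives the deletion of ab, so only the last
    -- vertex of the walk may be a.
    detour : ∀ x xs → x ≢ a → x ≢ b → All (a ≢_) xs → All (b ≢_) xs →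
      Linked _~_ (x ∷ xs ∷ʳ a) → Star _~′_ x a
    detour x [] x≢a x≢b [] [] (x~a ∷ _) = (x~a , x≢a ∘ proj₁ , x≢b ∘ proj₁) ◅ Star.ε
    detour x (y ∷ ys) x≢a x≢b (a≢y ∷ a≢ys) (b≢y ∷ b≢ys) (x~y ∷ ws) =
      (x~y , x≢a ∘ proj₁ , x≢b ∘ proj₁) ◅ detour y ys (≢-sym a≢y) (≢-sym b≢y) a≢ys b≢ys ws

    module _
      (connected : ∀ v → Star _~′_ v a)
      (acyclic : (D : Cycle G) → ¬ Linked _~′_ (Cycle.closedWalk D))
      where

      -- Indexing by length makes existence decidable at each length, so a least length can be found
      -- by search.
      Walk : ℕ → Fin n → Set
      Walk zero    v = v ≡ a
      Walk (suc k) v = ∃ λ w → v ~′ w × Walk k w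

      walk? : ∀ k → Decidable (Walk k)
      walk? zero    v = v ≟ a
      walk? (suc k) v = any? λ w → v ~′? w ×-dec walk? k w

      star⇒walk : ∀ {v} → Star _~′_ v a → ∃ λ k → Walk k v
      star⇒walk Star.ε = 0 , refl
      star⇒walk (e ◅ es) with star⇒walk es
      ... | k , w = suc k , _ , e , w

      private
        distance-spec : ∀ v → ∃ λ m → Walk m v × (∀ {j} → Walk j v → m ℕ.≤ j)
        distance-spec v = least (λ k → walk? k v) (proj₂ (star⇒walk (connected v)))

      distance : Fin n → ℕ
      distance v = proj₁ (distance-spec v)

      IsNext : Fin n → Fin n → Set
      IsNext v w = (v ≡ a × w ≡ b) ⊎ (v ~′ w × distance w ℕ.< distance v)

      closer : ∀ {k v} → v ≢ a → Walk k v → distance v ≡ k → ∃ (IsNext v)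
      closer {zero}  v≢a v≡a            _  = contradiction v≡a v≢a
      closer {suc k} v≢a (w , e , walk) eq =
        w , inj₂ (e , subst (distance w ℕ.<_) (sym eq) (s≤s (proj₂ (proj₂ (distance-spec w)) walk)))

      next-from : ∀ {v} → Dec (v ≡ a) → ∃ (IsNext v)
      next-from (yes v≡a) = b , inj₁ (v≡a , refl)
      next-from {v} (no v≢a) = closer v≢a (proj₁ (proj₂ (distance-spec v))) refl

      next-spec : ∀ v → ∃ (IsNext v)
      next-spec v = next-from (v ≟ a)

      next : Fin n → Fin n
      next v = proj₁ (next-spec v)

      next-a : next a ≡ b
      next-a with proj₂ (next-spec a)
      ... | inj₁ (_ , eq) = eq
      ... | inj₂ (_ , lt) = contradiction (proj₂ (proj₂ (distance-spec a)) {0} refl) (ℕ.<⇒≱ (ℕ.≤-<-trans z≤n lt))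

      Tree : Rel (Fin n) 0ℓ
      Tree u v = u ~′ v × (next u ≡ v ⊎ next v ≡ u)

      tree-sym : Symmetric Tree
      tree-sym (e , n) = ~′-sym e , Sum.swap n

      to-root : ∀ v → Acc ℕ._<_ (distance v) → Star Tree v a
      to-root v (acc rec) with proj₂ (next-spec v)
      ... | inj₁ (v≡a , _) = subst (λ w → Star Tree w a) (sym v≡a) Star.ε
      ... | inj₂ (e , lt)  = (e , inj₁ refl) ◅ to-root (next v) (rec lt)

      tree-connected : ∀ u v → Star Tree u v
      tree-connected u v = to-root u (<-wellFounded _) ◅◅ Star.reverse tree-sym (to-root v (<-wellFounded _))

      -- An edge outside the tree closes a cycle with the tree path between its ends.
      next-covers : ∀ {u v} → u ~ v → next u ≡ v ⊎ next v ≡ u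
      next-covers {u} {v} u~v with next u ≟ v | next v ≟ u
      ... | yes p | _     = inj₁ p
      ... | no _  | yes q = inj₂ q
      ... | no ¬p | no ¬q with ab-or-~′ u~v
      ...   | inj₁ (refl , refl) = inj₁ next-a
      ...   | inj₂ (inj₁ (refl , refl)) = inj₂ next-a
      ...   | inj₂ (inj₂ u~′v) with simplePath (tree-connected v u)
      ...     | []     , stop , _             = contradiction u~v (~-irrefl refl)
      ...     | _ ∷ [] , step (_ , t) stop , _ = Sum.swap t
      ...     | l@(x ∷ y ∷ _) , p , unique = contradiction
          (close (map-path p) u~′v)
          (acyclic record
            { start = v ; rest = l ; distinct = unique ; long = s≤s (s≤s z≤n)
            ; adjacent = Linked.map proj₁ (close (map-path p) u~′v) })
        where
        map-path : ∀ {x z l} → Path Tree x z l → Path _~′_ x z l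
        map-path stop            = stop
        map-path (step (e , _) p) = step e (map-path p)

      -- Two steps between vertices that each decrease the distance to a cannot return to the start,
      -- and a return involving the step from a to b would need the deleted edge.
      next-no-return : ∀ u → next (next u) ≢ u
      next-no-return u nn≡u with proj₂ (next-spec u)
      ... | inj₁ (refl , nu≡b) with proj₂ (next-spec (next u))
      ...   | inj₁ (nu≡a , _) = ~-irrefl (trans (sym nu≡a) nu≡b) a~b
      ...   | inj₂ ((_ , _ , ¬ba) , _) = ¬ba (nu≡b , nn≡u)
      next-no-return u nn≡u | inj₂ ((_ , _ , ¬ba) , lt) with proj₂ (next-spec (next u))
      ...   | inj₁ (nu≡a , nn≡b) = ¬ba (trans (sym nn≡u) nn≡b , nu≡a)
      ...   | inj₂ (_ , lt′) = ℕ.<-asym {distance (next u)} {distance u} lt (subst (λ w → distance w ℕ.< distance (next u)) nn≡u lt′)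

      orientation : Orientation G
      orientation = record
        { next      = next
        ; ~-next    = ~next
        ; covers    = next-covers
        ; no-return = next-no-return
        }
        where
        ~next : ∀ u → u ~ next u
        ~next u with proj₂ (next-spec u)
        ... | inj₁ (refl , eq) = subst (u ~_) (sym eq) a~b
        ... | inj₂ (e , _)     = proj₁ e

  -- Without the cycle edge ab the graph stays connected, because the rest of the cycle joins b to
  -- a, and it has no cycle left, because by uniqueness every cycle traverses ab.
  unicyclic⇒orientation : ∀ {n} (G : Graph n) → Unicyclic G → Orientation G
  unicyclic⇒orientation G (connected ,
      C@record { start = a ; rest = b ∷ c ∷ xs
               ; distinct = (a≢b ∷ a≢c ∷ a≢xs) ∷ (b≢c ∷ b≢xs) ∷ _
               ; adjacent = a~b ∷ b~c ∷ walk }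
    , unique) = orientation connected′ acyclic
    where
    open Graph G
    open Orient G a b a~b
    b⇝a : Star _~′_ b a
    b⇝a = (b~c , ≢-sym a≢b ∘ proj₁ , ≢-sym a≢c ∘ proj₂)
        ◅ detour c xs (≢-sym a≢c) (≢-sym b≢c) a≢xs b≢xs walk
    edge⇒star : ∀ {u v} → u ~ v → Star _~′_ u v
    edge⇒star u~v with ab-or-~′ u~v
    ... | inj₁ (refl , refl)        = Star.reverse ~′-sym b⇝a
    ... | inj₂ (inj₁ (refl , refl)) = b⇝a
    ... | inj₂ (inj₂ u~′v)          = u~′v ◅ Star.ε
    connected′ : ∀ v → Star _~′_ v a
    connected′ v = connected v a Star.>>= edge⇒star
    acyclic : (D : Cycle G) → ¬ Linked _~′_ (Cycle.closedWalk D)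
    acyclic D linked with Equivalence.to (unique D a b) (inj₁ ([] , _ , refl))
    ... | inj₁ (ys , zs , eq) = proj₁ (proj₂ (linked⇒consecutive ys (subst (Linked _~′_) eq linked))) (refl , refl)
    ... | inj₂ (ys , zs , eq) = proj₂ (proj₂ (linked⇒consecutive ys (subst (Linked _~′_) eq linked))) (refl , refl)
  unicyclic⇒orientation G (_ , record { rest = [] ; long = () } , _)
  unicyclic⇒orientation G (_ , record { rest = _ ∷ [] ; long = s≤s () } , _)

  -- Counting indegrees

  indicator : ∀ {P : Set} → Dec P → ℕ
  indicator P? = if does P? then 1 else 0

  length-filter-tabulate : ∀ {A : Set} {P : A → Set} (P? : Decidable P) {n} (f : Fin n → A) →
    length (filter P? (tabulate f)) ≡ ∑ (λ i → indicator (P? (f i)))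
  length-filter-tabulate P? {zero}  f = refl
  length-filter-tabulate P? {suc n} f with does (P? (f zero))
  ... | true  = cong suc (length-filter-tabulate P? (f ∘ suc))
  ... | false = length-filter-tabulate P? (f ∘ suc)

  ∑-indicator : ∀ {n} (c : Fin n) → ∑ (λ v → indicator (c ≟ v)) ≡ 1
  ∑-indicator {suc n} zero    = cong suc (sum-replicate-zero n)
  ∑-indicator {suc n} (suc c) = ∑-indicator c

  ∑-ones : ∀ n → ∑ {n} (λ _ → 1) ≡ n
  ∑-ones zero    = refl
  ∑-ones (suc n) = cong suc (∑-ones n)

  term≤∑ : ∀ {n} (f : Fin n → ℕ) i → f i ℕ.≤ ∑ f
  term≤∑ f zero    = ℕ.m≤m+n _ _
  term≤∑ f (suc i) = ℕ.≤-trans (term≤∑ (f ∘ suc) i) (ℕ.m≤n+m _ _)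

  sum-tabulate : ∀ {n} (f : Fin n → ℕ) → sum (tabulate f) ≡ ∑ f
  sum-tabulate {zero}  f = refl
  sum-tabulate {suc n} f = cong (f zero +_) (sum-tabulate (f ∘ suc))

  ∈⇒↭∷ : ∀ {A : Set} {x : A} {xs} → x ∈ xs → ∃ λ ys → xs ↭ x ∷ ys
  ∈⇒↭∷ x∈xs with ∈-∃++ x∈xs
  ... | ys , zs , refl = ys ++ zs , shift _ ys zs

  ∈-∷⁻ : ∀ {A : Set} {x y : A} {xs} → x ≢ y → x ∈ y ∷ xs → x ∈ xs
  ∈-∷⁻ x≢y (here x≡y) = contradiction x≡y x≢y
  ∈-∷⁻ x≢y (there x∈) = x∈

  module Indegrees {n : ℕ} (G : Graph n) (O : Orientation G) where
    open Graph G
    open Orientation O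

    indegree : Fin n → ℕ
    indegree v = ∑ (λ u → indicator (next u ≟ v))

    indicator-~ : ∀ u v → indicator (u ~? v) ≡ indicator (next u ≟ v) + indicator (next v ≟ u)
    indicator-~ u v with u ~? v | next u ≟ v | next v ≟ u
    ... | yes _   | yes nu≡v | yes nv≡u = contradiction (trans (cong next nu≡v) nv≡u) (no-return u)
    ... | yes _   | yes _    | no _     = refl
    ... | yes _   | no _     | yes _    = refl
    ... | no _    | no _     | no _     = refl
    ... | no u≁v  | yes nu≡v | _        = contradiction (subst (u ~_) nu≡v (~-next u)) u≁v
    ... | no u≁v  | no _     | yes nv≡u = contradiction (~-sym (subst (v ~_) nv≡u (~-next v))) u≁v
    ... | yes u~v | no nu≢v  | no nv≢u with covers u~v
    ...   | inj₁ nu≡v = contradiction nu≡v nu≢v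
    ...   | inj₂ nv≡u = contradiction nv≡u nv≢u

    degree≡suc-indegree : ∀ u → degree G u ≡ suc (indegree u)
    degree≡suc-indegree u = begin
      degree G u                                                    ≡⟨ length-filter-tabulate (u ~?_) id ⟩
      ∑ (λ v → indicator (u ~? v))                                  ≡⟨ sum-cong-≗ (indicator-~ u) ⟩
      ∑ (λ v → indicator (next u ≟ v) + indicator (next v ≟ u))
        ≡⟨ ∑-distrib-+ (λ v → indicator (next u ≟ v)) (λ v → indicator (next v ≟ u)) ⟩
      ∑ (λ v → indicator (next u ≟ v)) + indegree u                 ≡⟨ cong (_+ indegree u) (∑-indicator (next u)) ⟩
      suc (indegree u)                                              ∎
      where open ≡-Reasoning

    indegrees : List ℕ
    indegrees = tabulate indegree

    degrees≡ : degrees G ≡ map suc indegrees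
    degrees≡ = trans (map-tabulate id (degree G))
      (trans (tabulate-cong degree≡suc-indegree) (sym (map-tabulate indegree suc)))

    sum-indegrees : sum indegrees ≡ n
    sum-indegrees = begin
      sum indegrees                                 ≡⟨ sum-tabulate indegree ⟩
      ∑ (λ v → ∑ (λ u → indicator (next u ≟ v)))    ≡⟨ ∑-comm (λ v u → indicator (next u ≟ v)) ⟩
      ∑ (λ u → ∑ (λ v → indicator (next u ≟ v)))    ≡⟨ sum-cong-≗ (λ u → ∑-indicator (next u)) ⟩
      ∑ {n} (λ _ → 1)                               ≡⟨ ∑-ones n ⟩
      n                                             ∎
      where open ≡-Reasoning

    indegree-next : ∀ u → ∃ λ k → indegree (next u) ≡ suc k
    -- The summand belonging to u itself equals 1, which excludes the value 0.
    indegree-next u with indegree (next u)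
      | subst (ℕ._≤ indegree (next u)) (cong (if_then 1 else 0) (dec-true (next u ≟ next u) refl))
          (term≤∑ (λ w → indicator (next w ≟ next u)) u)
    ... | suc k | _ = k , refl

    -- m, next m and next (next m) are distinct, and the last two are heads of arcs.
    two-more-positive : ∀ {D} → D ∈ indegrees →
      ∃ λ b → ∃₂ λ c xs → indegrees ↭ D ∷ suc b ∷ suc c ∷ xs
    two-more-positive D∈ with ∈-tabulate⁻ D∈
    ... | m , refl = proj₁ (indegree-next m) , proj₁ (indegree-next (next m)) , map indegree rest₃ ,
        ↭-trans (↭-reflexive (sym (map-tabulate id indegree)))
          (↭-trans (map⁺ indegree split)
            (↭-reflexive (cong₂ (λ u v → indegree m ∷ u ∷ v ∷ map indegree rest₃)
              (proj₂ (indegree-next m)) (proj₂ (indegree-next (next m))))))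
      where
      next-≢ : ∀ u → next u ≢ u
      next-≢ u nu≡u = ~-irrefl (sym nu≡u) (~-next u)
      e₁ = ∈⇒↭∷ (∈-allFin m)
      rest₁ = proj₁ e₁
      e₂ = ∈⇒↭∷ (∈-∷⁻ (next-≢ m) (∈-resp-↭ (proj₂ e₁) (∈-allFin (next m))))
      rest₂ = proj₁ e₂
      e₃ = ∈⇒↭∷ (∈-∷⁻ (next-≢ (next m)) (∈-resp-↭ (proj₂ e₂)
             (∈-∷⁻ (no-return m) (∈-resp-↭ (proj₂ e₁) (∈-allFin (next (next m)))))))
      rest₃ = proj₁ e₃
      split : allFin n ↭ m ∷ next m ∷ next (next m) ∷ rest₃
      split = ↭-trans (proj₂ e₁) (prep m (↭-trans (proj₂ e₂) (prep (next m) (proj₂ e₃))))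

open Orientations

-- The extremal sequences

quotient-unique : ∀ {D} .{{_ : NonZero D}} q {r n} → r ℕ.< D → r ℕ.+ q ℕ.* D ≡ n → n / D ≡ q
quotient-unique {D} q {r} r<D ≡.refl = ≡.trans (+-distrib-/-∣ʳ r (n∣m*n q))
  (≡.cong₂ ℕ._+_ (m<n⇒m/n≡0 r<D) (m*n/n≡m q D))

private
  ≥-order = Flip.decTotalOrder ℕ.≤-decTotalOrder

↭⇒sort≡ : ∀ {xs ys} → xs ↭ ys → Linked ℕ._≥_ ys → Sort.sort ≥-order xs ≡ ys
↭⇒sort≡ {xs} xs↭ys ys↘ = Pointwise.Pointwise-≡⇒≡
  (↗↭↗⇒≋ (DecTotalOrder.totalOrder ≥-order) (Sort.sort-↗ ≥-order xs) ys↘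
    (↭⇒↭ₛ (↭-trans (Sort.sort-↭ ≥-order xs) xs↭ys)))

map-suc-↭⁻ : ∀ {xs ys} → map suc xs ↭ map suc ys → xs ↭ ys
map-suc-↭⁻ {xs} {ys} p = ≡.subst₂ _↭_ (pred∘suc xs) (pred∘suc ys) (map⁺ ℕ.pred p)
  where
  pred∘suc : ∀ zs → map ℕ.pred (map suc zs) ≡ zs
  pred∘suc zs = ≡.trans (≡.sym (map-∘ zs)) (map-id zs)

zeros-sorted : ∀ r j → Linked ℕ._≥_ (r ∷ replicate j 0)
zeros-sorted r zero    = [-]
zeros-sorted r (suc j) = z≤n ∷ zeros-sorted 0 j

replicate-sorted : ∀ {D r xs} q → r ℕ.≤ D → Linked ℕ._≥_ (r ∷ xs) → Linked ℕ._≥_ (replicate q D ++ r ∷ xs)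
replicate-sorted zero          r≤D s = s
replicate-sorted (suc zero)    r≤D s = r≤D ∷ s
replicate-sorted (suc (suc q)) r≤D s = ℕ.≤-refl ∷ replicate-sorted (suc q) r≤D s

sum-replicate-0 : ∀ j → sum (replicate j 0) ≡ 0
sum-replicate-0 zero    = ≡.refl
sum-replicate-0 (suc j) = sum-replicate-0 j

sum-replicate : ∀ q D → sum (replicate q D) ≡ q ℕ.* D
sum-replicate zero    D = ≡.refl
sum-replicate (suc q) D = ≡.cong (D ℕ.+_) (sum-replicate q D)

maxDegree-attained : ∀ {n Δ} (G : Graph n) → maxDegree G ≡ suc Δ → suc Δ ∈ degrees G
maxDegree-attained G eq with Extrema.argmax-sel ℕ.≤-totalOrder id 0 (degrees G)
-- The maximum is either the default 0 or an entry of the list, and a successor is not the default.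
... | inj₁ max≡0 = contradiction (≡.trans (≡.sym eq) max≡0) λ ()
... | inj₂ max∈  = ≡.subst (_∈ degrees G) eq max∈

extremalSequence-flat : ∀ n Δ .(3≤Δ : 3 ℕ.≤ Δ) → quot n Δ 3≤Δ ≡ 1 ⊎ n ≡ 2 ℕ.* Δ ∸ 2 →
  extremalSequence n Δ 3≤Δ ≡ Δ ∷ n ∸ Δ ℕ.+ 1 ∷ 2 ∷ replicate (n ∸ 3) 1
extremalSequence-flat n Δ 3≤Δ condition =
  ≡.cong (if_then (Δ ∷ n ∸ Δ ℕ.+ 1 ∷ 2 ∷ replicate (n ∸ 3) 1)
          else (replicate q Δ ++ (n ∸ q ℕ.* (Δ ∸ 1) ℕ.+ 1) ∷ replicate (n ∸ q ∸ 1) 1))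
    (dec-true ((q ℕ.≟ 1) ⊎-dec (n ℕ.≟ 2 ℕ.* Δ ∸ 2)) condition)
  where q = quot n Δ 3≤Δ

extremalSequence-steep : ∀ n Δ .(3≤Δ : 3 ℕ.≤ Δ) → ¬ (quot n Δ 3≤Δ ≡ 1 ⊎ n ≡ 2 ℕ.* Δ ∸ 2) →
  let q = quot n Δ 3≤Δ in
  extremalSequence n Δ 3≤Δ ≡ replicate q Δ ++ (n ∸ q ℕ.* (Δ ∸ 1) ℕ.+ 1) ∷ replicate (n ∸ q ∸ 1) 1
extremalSequence-steep n Δ 3≤Δ condition =
  ≡.cong (if_then (Δ ∷ n ∸ Δ ℕ.+ 1 ∷ 2 ∷ replicate (n ∸ 3) 1)
          else (replicate q Δ ++ (n ∸ q ℕ.* (Δ ∸ 1) ℕ.+ 1) ∷ replicate (n ∸ q ∸ 1) 1))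
    (dec-false ((q ℕ.≟ 1) ⊎-dec (n ℕ.≟ 2 ℕ.* Δ ∸ 2)) condition)
  where q = quot n Δ 3≤Δ

-- The two extremal sequences lowered by 1 in every entry, with D = Δ - 1: these are the targets for
-- the indegrees.
flatExcess : ℕ → ℕ → List ℕ
flatExcess n D = D ∷ n ∸ suc D ∷ 1 ∷ replicate (n ∸ 3) 0

steepExcess : ℕ → ℕ → ℕ → List ℕ
steepExcess n D q = replicate q D ++ n ∸ q ℕ.* D ∷ replicate (n ∸ q ∸ 1) 0

-- The entry that `concentrate₂` leaves open is determined by the sum n. Being a successor, it is at
-- least 1, as the sorted order requires.
⊒-flatExcess : ∀ {n D b c rest xs} → length xs ≡ n → sum xs ≡ n → xs ↭ D ∷ suc b ∷ suc c ∷ rest →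
  xs ⊒ flatExcess n D × 1 ℕ.≤ n ∸ suc D
⊒-flatExcess {n} {D} {b} {c} {rest} {xs} length≡ sum≡ xs↭ with concentrate₂ D b c rest
... | N , d = ≡.subst₂ (λ u k → xs ⊒ D ∷ u ∷ 1 ∷ replicate k 0) suc-N≡ rest≡ xs⊒ , ≡.subst (1 ℕ.≤_) suc-N≡ (s≤s z≤n)
  where
  xs⊒ = ⊒-trans (perm xs↭) d
  rest≡ : length rest ≡ n ∸ 3
  rest≡ = ≡.cong (_∸ 3) (≡.trans (≡.sym (↭-length xs↭)) length≡)
  n≡ : n ≡ suc D ℕ.+ suc N
  n≡ = ≡.trans (≡.sym sum≡) (≡.trans (⊒-sum xs⊒)
    (≡.trans (≡.cong (λ t → D ℕ.+ (suc N ℕ.+ suc t)) (sum-replicate-0 (length rest)))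
      (≡.trans (≡.cong (D ℕ.+_) (ℕ.+-comm (suc N) 1)) (ℕ.+-suc D (suc N)))))
  suc-N≡ : suc N ≡ n ∸ suc D
  suc-N≡ = ≡.sym (≡.trans (≡.cong (_∸ suc D) n≡) (ℕ.m+n∸m≡n (suc D) (suc N)))

flatExcess-sorted : ∀ {n D} → n ℕ.≤ D ℕ.+ D → 1 ℕ.≤ n ∸ suc D → Linked ℕ._≥_ (flatExcess n D)
flatExcess-sorted {n} {D} n≤2D 1≤n∸Δ =
  ℕ.m≤n+o⇒m∸n≤o n (suc D) (ℕ.≤-trans n≤2D (ℕ.n≤1+n _)) ∷ 1≤n∸Δ ∷ zeros-sorted 1 (n ∸ 3)

flatExcess-suc : ∀ n D → suc D ∷ n ∸ suc D ℕ.+ 1 ∷ 2 ∷ replicate (n ∸ 3) 1 ≡ map suc (flatExcess n D)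
flatExcess-suc n D = ≡.cong₂ (λ u l → suc D ∷ u ∷ 2 ∷ l) (ℕ.+-comm (n ∸ suc D) 1) (≡.sym (map-replicate suc (n ∸ 3) 0))

⊒-steepExcess : ∀ {n D xs} .{{_ : NonZero D}} → 2 ℕ.≤ D → 1 ℕ.≤ n / D → length xs ≡ n → sum xs ≡ n → All (ℕ._≤ D) xs →
  0 ∷ xs ⊒ 0 ∷ steepExcess n D (n / D) × n ∸ n / D ℕ.* D ℕ.< D
⊒-steepExcess {n} {D} {xs} 2≤D 1≤q length≡ sum≡ xs≤D with concentrate xs (ℕ.≤-trans (s≤s z≤n) 2≤D) xs≤D
... | q , r , j , r<D , d = xs⊒zs , ≡.subst (ℕ._< D) r≡ r<D
  where
  n≡ : r ℕ.+ q ℕ.* D ≡ n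
  n≡ = ≡.trans (≡.sym (≡.trans (⊒-sum d) (≡.cong (r ℕ.+_)
    (≡.trans (sum-++ (replicate q D) _) (≡.trans (≡.cong₂ ℕ._+_ (sum-replicate q D) (sum-replicate-0 j))
      (ℕ.+-identityʳ _)))))) sum≡
  n/D≡q : n / D ≡ q
  n/D≡q = quotient-unique q r<D n≡
  r≡ : r ≡ n ∸ n / D ℕ.* D
  r≡ = ≡.trans (≡.sym (ℕ.m+n∸n≡m r (q ℕ.* D))) (≡.cong₂ (λ u v → u ∸ v ℕ.* D) n≡ (≡.sym n/D≡q))
  q+j≡n : q ℕ.+ j ≡ n
  q+j≡n = ℕ.suc-injective (≡.trans (≡.cong suc (≡.sym (≡.trans (length-++ (replicate q D))
    (≡.cong₂ ℕ._+_ (length-replicate q) (length-replicate j)))))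
    (≡.trans (≡.sym (⊒-length d)) (≡.cong suc length≡)))
  -- As D is at least 2 and q at least 1, q < q D, which is at most n. Hence j is positive: one of
  -- the j zeros can change places with the r at the head.
  q<n : q ℕ.< n
  q<n = ≡.subst (q ℕ.<_) n≡ (ℕ.<-≤-trans
    (≡.subst (ℕ._< q ℕ.* D) (ℕ.*-identityʳ q)
      (ℕ.*-monoʳ-< q {{ℕ.>-nonZero (≡.subst (1 ℕ.≤_) n/D≡q 1≤q)}} 2≤D))
    (ℕ.m≤n+m _ r))
  j≡ : j ≡ suc (n ∸ n / D ∸ 1)
  j≡ = ≡.trans (≡.sym (ℕ.m+n∸m≡n q j)) (≡.trans (≡.cong (_∸ q) q+j≡n)
    (≡.trans (≡.sym (ℕ.m+[n∸m]≡n (ℕ.m<n⇒0<n∸m q<n))) (≡.cong (λ t → suc (n ∸ t ∸ 1)) (≡.sym n/D≡q))))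
  exchange : ∀ r a k → r ∷ replicate a D ++ 0 ∷ replicate k 0 ↭ 0 ∷ replicate a D ++ r ∷ replicate k 0
  exchange r a k = ↭-trans (prep r (shift 0 (replicate a D) _))
    (↭-trans (swap r 0 ↭-refl) (prep 0 (↭-sym (shift r (replicate a D) _))))
  xs⊒zs : 0 ∷ xs ⊒ 0 ∷ steepExcess n D (n / D)
  xs⊒zs = ⊒-trans
    (≡.subst₂ (λ u v → 0 ∷ xs ⊒ u ∷ v) r≡ (≡.cong₂ (λ a k → replicate a D ++ replicate k 0) (≡.sym n/D≡q) j≡) d)
    (perm (exchange _ (n / D) _))

steepExcess-suc : ∀ n D q →
  replicate q (suc D) ++ (n ∸ q ℕ.* D ℕ.+ 1) ∷ replicate (n ∸ q ∸ 1) 1 ≡ map suc (steepExcess n D q)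
steepExcess-suc n D q = ≡.sym (≡.trans (map-++ suc (replicate q D) _) (≡.cong₂ _++_ (map-replicate suc q D)
  (≡.cong₂ _∷_ (ℕ.+-comm 1 _) (map-replicate suc (n ∸ q ∸ 1) 0))))

-- A quotient 1 gives n < 2D, and the exceptional case is n = 2D. The bound keeps the second entry n
-- - D - 1 from exceeding D.
flat⇒n≤2D : ∀ n D .{{_ : NonZero D}} → n / D ≡ 1 ⊎ n ≡ 2 ℕ.* suc D ∸ 2 → n ℕ.≤ D ℕ.+ D
flat⇒n≤2D n D (inj₁ q≡1) = ℕ.<⇒≤ (≡.subst (ℕ._< D ℕ.+ D)
  (≡.sym (≡.trans (m≡m%n+[m/n]*n n D) (≡.cong (n % D ℕ.+_) (≡.trans (≡.cong (ℕ._* D) q≡1) (ℕ.*-identityˡ D)))))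
  (ℕ.+-monoˡ-< D (m%n<n n D)))
flat⇒n≤2D n D (inj₂ n≡2Δ-2) = ℕ.≤-reflexive (≡.trans n≡2Δ-2
  (≡.trans (≡.sym (ℕ.*-distribˡ-∸ 2 (suc D) 1)) (≡.cong (D ℕ.+_) (ℕ.+-identityʳ D))))

-- The bounds and their cases of equality

module _ {c ℓ₁ ℓ₂ : Level} (R : RealNumberSystem c ℓ₁ ℓ₂) where
  open OrderedField R
  open Midpoints R
  open WeightedProducts R

  module _ {f : Carrier → Carrier} (f⁺ : IsPositiveFunction f) (f-lc : LogConcave f) where

    private
      Ψ : ℕ → Carrier
      Ψ k = f (fromℕ (suc k))
    open Weights Ψ (fromℕ-suc-pos f⁺) (logConcave⇒midpoint f⁺ f-lc)

    weight-++ : ∀ xs ys → weight (xs ++ ys) ≈ weight xs * weight ys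
    weight-++ []       ys = sym (*-identityˡ _)
    weight-++ (x ∷ xs) ys = trans (*-congˡ (weight-++ xs ys)) (sym (*-assoc _ _ _))

    weight-replicate : ∀ q k → weight (replicate q k) ≈ Ψ k ^ q
    weight-replicate zero    k = refl
    weight-replicate (suc q) k = *-congˡ (weight-replicate q k)

    product≈weight : ∀ {n} (d e : Fin n → ℕ) → (∀ i → d i ≡ suc (e i)) →
      product (λ i → f (fromℕ (d i))) ≈ weight (tabulate e)
    product≈weight {zero}  d e eq = refl
    product≈weight {suc n} d e eq = *-cong (reflexive (≡.cong (f ∘ fromℕ) (eq zero)))
      (product≈weight (d ∘ suc) (e ∘ suc) (eq ∘ suc))

    private
      F : ℕ → Carrier
      F k = f (fromℕ k)

      F[1+] : ∀ k → F (1 ℕ.+ k) ≈ F (k ℕ.+ 1)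
      F[1+] k = reflexive (≡.cong F (ℕ.+-comm 1 k))

    weight-flat : ∀ n D → weight (flatExcess n D) ≈ F (suc D) * F (n ∸ suc D ℕ.+ 1) * F 2 * F 1 ^ (n ∸ 3)
    weight-flat n D = trans (sym (trans (*-assoc _ _ _) (*-assoc _ _ _)))
      (*-cong (*-congʳ (*-congˡ (F[1+] (n ∸ suc D)))) (weight-replicate (n ∸ 3) 0))

    weight-steep : ∀ n D q →
      weight (steepExcess n D q) ≈ F (suc D) ^ q * F (n ∸ q ℕ.* D ℕ.+ 1) * F 1 ^ (n ∸ q ∸ 1)
    weight-steep n D q = trans (weight-++ (replicate q D) _) (trans (sym (*-assoc _ _ _))
      (*-cong (*-cong (weight-replicate q D) (F[1+] (n ∸ q ℕ.* D))) (weight-replicate (n ∸ q ∸ 1) 0)))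

    -- The converse asks for strict log-concavity because a constant `f` attains the bound on every
    -- graph.
    Sharp : ∀ {n Δ} .(3≤Δ : 3 ℕ.≤ Δ) → Graph n → Carrier → Set (c ⊔ ℓ₁ ⊔ ℓ₂)
    Sharp {n} {Δ} 3≤Δ G B =
      B ≤ II f G × (𝒦 n Δ 3≤Δ G → II f G ≈ B) × (StrictlyLogConcave f → II f G ≈ B → 𝒦 n Δ 3≤Δ G)

    -- Both lists carry the extra 0 that `concentrate` works with; its positive weight cancels from
    -- the inequality. In the case of equality the product cannot have dropped strictly, so the
    -- derivation is a permutation, and a sorted list is determined by its entries.
    sharp : ∀ {n Δ} .(3≤Δ : 3 ℕ.≤ Δ) (G : Graph n) → Unicyclic G → ∀ xs zs {B} →
      degrees G ≡ map suc xs → II f G ≈ weight xs →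
      extremalSequence n Δ 3≤Δ ≡ map suc zs → Linked ℕ._≥_ zs →
      0 ∷ xs ⊒ 0 ∷ zs → weight zs ≈ B →
      Sharp 3≤Δ G B
    sharp {n} {Δ} 3≤Δ G unicyclic xs zs {B} degrees≡ II≈ z≡ zs↘ xs⊒zs zs≈B = bound , equality , rigidity
      where
      bound : B ≤ II f G
      bound = ≤-trans (≤-reflexive (sym zs≈B))
        (≤-trans (λ lt → weight-≤ xs⊒zs (*-monoʳ-< (fromℕ-suc-pos f⁺ 0) lt)) (≤-reflexive (sym II≈)))
      equality : 𝒦 n Δ 3≤Δ G → II f G ≈ B
      equality (_ , sequence≡) = trans II≈ (trans (weight-↭ (map-suc-↭⁻
        (≡.subst₂ _↭_ degrees≡ (≡.trans sequence≡ z≡) (↭-sym (Sort.sort-↭ ≥-order (degrees G)))))) zs≈B)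
      rigidity : StrictlyLogConcave f → II f G ≈ B → 𝒦 n Δ 3≤Δ G
      rigidity strict II≈B = unicyclic , ≡.trans (↭⇒sort≡ degrees↭ (Linked.map⁺ (Linked.map s≤s zs↘))) (≡.sym z≡)
        where
        xs↭zs : xs ↭ zs
        xs↭zs = [ drop-∷
                , (λ lt → contradiction lt (<-irrefl (*-congˡ (trans zs≈B (trans (sym II≈B) II≈))))) ]′
                (weight-< (strictlyLogConcave⇒midpoint f⁺ strict) xs⊒zs)
        degrees↭ : degrees G ↭ map suc zs
        degrees↭ = ≡.subst (_↭ map suc zs) (≡.sym degrees≡) (map⁺ suc xs↭zs)

    module _ {n D : ℕ} (G : Graph n) (O : Orientation G) (unicyclic : Unicyclic G)
      (maxDegree≡ : maxDegree G ≡ suc D) (3≤Δ : 3 ℕ.≤ suc D) where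
      open Indegrees G O

      private
        q = quot n (suc D) 3≤Δ

        instance
          D≢0 : NonZero D
          D≢0 = ℕ.>-nonZero (ℕ.≤-trans (s≤s z≤n) (ℕ.∸-monoˡ-≤ 1 3≤Δ))

      II≈weight : II f G ≈ weight indegrees
      II≈weight = product≈weight (degree G) indegree degree≡suc-indegree

      D∈indegrees : D ∈ indegrees
      D∈indegrees with ∈-map⁻ suc (≡.subst (suc D ∈_) degrees≡ (maxDegree-attained G maxDegree≡))
      ... | _ , d∈ , ≡.refl = d∈

      indegrees≤D : All (ℕ._≤ D) indegrees
      indegrees≤D = All.map ℕ.≤-pred
        (All.map⁻ (≡.subst₂ (λ m → All (ℕ._≤ m)) maxDegree≡ degrees≡ (xs≤max 0 (degrees G))))

      sharp-flat : q ≡ 1 ⊎ n ≡ 2 ℕ.* suc D ∸ 2 →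
        Sharp 3≤Δ G (F (suc D) * F (n ∸ suc D ℕ.+ 1) * F 2 * F 1 ^ (n ∸ 3))
      sharp-flat condition = sharp 3≤Δ G unicyclic indegrees (flatExcess n D) degrees≡ II≈weight
        (≡.trans (extremalSequence-flat n (suc D) 3≤Δ condition) (flatExcess-suc n D))
        (flatExcess-sorted (flat⇒n≤2D n D condition) (proj₂ flat))
        (cons 0 (proj₁ flat))
        (weight-flat n D)
        where
        flat : indegrees ⊒ flatExcess n D × 1 ℕ.≤ n ∸ suc D
        flat = ⊒-flatExcess (length-tabulate indegree) sum-indegrees
          (proj₂ (proj₂ (proj₂ (two-more-positive D∈indegrees))))

      sharp-steep : 1 ℕ.< q × n ≢ 2 ℕ.* suc D ∸ 2 →
        Sharp 3≤Δ G (F (suc D) ^ q * F (n ∸ q ℕ.* D ℕ.+ 1) * F 1 ^ (n ∸ q ∸ 1))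
      sharp-steep (1<q , n≢2Δ-2) = sharp 3≤Δ G unicyclic indegrees (steepExcess n D q) degrees≡ II≈weight
        (≡.trans (extremalSequence-steep n (suc D) 3≤Δ
            λ { (inj₁ q≡1) → ℕ.<⇒≢ 1<q (≡.sym q≡1) ; (inj₂ n≡) → n≢2Δ-2 n≡ })
          (steepExcess-suc n D q))
        (replicate-sorted q (ℕ.<⇒≤ (proj₂ steep)) (zeros-sorted _ _))
        (proj₁ steep)
        (weight-steep n D q)
        where
        steep : 0 ∷ indegrees ⊒ 0 ∷ steepExcess n D q × n ∸ q ℕ.* D ℕ.< D
        steep = ⊒-steepExcess (ℕ.≤-pred 3≤Δ) (ℕ.<⇒≤ 1<q) (length-tabulate indegree) sum-indegrees indegrees≤D

theorem4p10 : {c ℓ₁ ℓ₂ : Level} (R : RealNumberSystem c ℓ₁ ℓ₂) →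
  let open RealAnalysis R in
  (n Δ : ℕ) (G : Graph n) → 4 ℕ.≤ n → Unicyclic G →
  maxDegree G ≡ Δ → (3≤Δ : 3 ℕ.≤ Δ) →
  (f : Carrier → Carrier) → IsPositiveFunction f → LogConcave f →
  let q = quot n Δ 3≤Δ
      F = λ (k : ℕ) → f (fromℕ k)
      B₁ = F Δ * F (n ℕ.∸ Δ ℕ.+ 1) * F 2 * F 1 ^ (n ℕ.∸ 3)
      B₂ = F Δ ^ q * F (n ℕ.∸ q ℕ.* (Δ ℕ.∸ 1) ℕ.+ 1) * F 1 ^ (n ℕ.∸ q ℕ.∸ 1)
  in
  (q ≡ 1 ⊎ n ≡ 2 ℕ.* Δ ℕ.∸ 2 →
    B₁ ≤ II f G
    × (𝒦 n Δ 3≤Δ G → II f G ≈ B₁)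
    × (StrictlyLogConcave f → II f G ≈ B₁ → 𝒦 n Δ 3≤Δ G))
  ×
  (1 ℕ.< q × n ≢ 2 ℕ.* Δ ℕ.∸ 2 →
    B₂ ≤ II f G
    × (𝒦 n Δ 3≤Δ G → II f G ≈ B₂)
    × (StrictlyLogConcave f → II f G ≈ B₂ → 𝒦 n Δ 3≤Δ G))
theorem4p10 R n (suc D) G 4≤n unicyclic maxDegree≡ 3≤Δ f f⁺ f-lc =
    sharp-flat  R f⁺ f-lc G (unicyclic⇒orientation G unicyclic) unicyclic maxDegree≡ 3≤Δ
  , sharp-steep R f⁺ f-lc G (unicyclic⇒orientation G unicyclic) unicyclic maxDegree≡ 3≤Δ
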